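{- Let $k \in \mathbb{N}$ with $k\ge 2$, let $\xi>0$, and let $G$ be a $\xi$-expanding $k$-graph on $n$ vertices. Then \[ c(G) \leq 20\, \xi^{ -2} \sqrt{\frac{n}{k}}\, \log n . \]
   Context: A $k$-graph is a $k$-uniform hypergraph. Cops and Robber on a hypergraph $H$: one player places $m$ cops on vertices, then the other player places a single robber on a vertex; then the players alternate turns (cops first), and in a turn a player may move each of their pieces to a vertex sharing an edge with its current vertex, or leave it in place (several cops may share a vertex). Both players have full information. The cops win if at some point a cop occupies the robber's vertex. The cop number $c(H)$ is the minimum $m$ such that $m$ cops have a winning strategy. Distance: for distinct vertices $x,y$, $\mathrm{dist}(x,y)$ is the smallest $t$ such that there are edges $e_1,\dots,e_t$ with $x\in e_1$, $y\in e_t$ and $e_i\cap e_{i+1}\neq\emptyset$ for all $i$; $\mathrm{dist}(x,x)=0$. For vertex sets $A,A'$, $\mathrm{dist}(A,A')=\min_{u\in A,v\in A'}\mathrm{dist}(u,v)$ (an edge is regarded as its vertex set). For $A\subseteq V(G)$ and $r\in\mathbb{N}_0$, $N_V^r(A)=\{v:\mathrm{dist}(A,v)\le r\}$; for $r\in\mathbb{N}$, $N_E^r(A)=\{e\in E(G):\mathrm{dist}(e,A)\le r-1\}$. For $B\subseteq E(G)$, $V_B=\bigcup_{e\in B}e$ and $N_V^r(B)=N_V^r(V_B)$. The average vertex degree is $d(G)=\frac1{|V(G)|}\sum_{v}|N_V^1(v)|$. $\xi$-expanding: Let $G$ be a $k$-graph on $n$ vertices with average vertex degree $d\ge k$ and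 let $0<\xi\le 1$. $G$ is $\xi$-expanding if: (A.1) for every vertex $v$ and $r\in\mathbb{N}$ with $d^r\le\sqrt{nk}$, $|N_E^r(v)|\le \frac1\xi\frac{d^r}{k}$; (A.2) for every $A\subseteq V(G)$ and $r\in\mathbb{N}$, $\xi\min\{|A|d^r,n\}\le |N_V^r(A)|\le \frac1\xi|A|d^r$; (A.3) for every $B\subseteq E(G)$ and $r\in\mathbb{N}$, $\xi\min\{|B|kd^r,n\}\le|N_V^r(B)|$.
   Formalization: The parameter ξ is taken to be rational rather than real; the real case follows since a ξ-expanding graph is ξ'-expanding for every rational 0 < ξ' ≤ ξ and the bound is continuous in ξ. -}

module Defs where

open import Data.Nat as ℕ using (ℕ; zero; suc; _≤_)
open import Data.Integer using (+_)
open import Data.Rational as ℚ using (ℚ; 0ℚ; 1ℚ; _/_)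
open import Data.Fin using (Fin)
open import Data.Fin.Subset using (Subset; _∈_; ∣_∣; ⁅_⁆)
open import Data.Product using (Σ; ∃; _×_; _,_)
open import Data.Sum using (_⊎_)
open import Data.Empty using (⊥)
open import Relation.Binary.PropositionalEquality using (_≡_)
open import Function.Definitions using (Injective)
open import Function.Bundles using (_⇔_)

record KGraph (k n : ℕ) : Set where
  field
    m         : ℕ
    edge      : Fin m → Subset n
    edge-inj  : Injective _≡_ _≡_ edge
    edge-size : ∀ i → ∣ edge i ∣ ≡ k
open KGraph public

module _ {k n : ℕ} (G : KGraph k n) where

  -- Chain e_1,…,e_t (t ≥ 1) with x ∈ e_1, y ∈ e_t, e_i ∩ e_{i+1} ≠ ∅.
  -- Chain t x y encodes a chain of t+1 edges.
  Chain : ℕ → Fin n → Fin n → Set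
  Chain zero    x y = ∃ λ i → x ∈ edge G i × y ∈ edge G i
  Chain (suc t) x y = ∃ λ i → x ∈ edge G i × ∃ λ z → z ∈ edge G i × Chain t z y

  DistLe : Fin n → Fin n → ℕ → Set
  DistLe x y r = x ≡ y ⊎ ∃ λ t → suc t ≤ r × Chain t x y

  DistSetLe : Subset n → Fin n → ℕ → Set
  DistSetLe A y r = ∃ λ u → u ∈ A × DistLe u y r

  IsNV : ℕ → Subset n → Subset n → Set
  IsNV r A S = ∀ v → (v ∈ S ⇔ DistSetLe A v r)

  IsVB : Subset (m G) → Subset n → Set
  IsVB B W = ∀ v → (v ∈ W ⇔ ∃ λ i → i ∈ B × v ∈ edge G i)

  -- T is N_E^r(v) (r ≥ 1): edges e with dist(e,v) ≤ r-1
  IsNE : ℕ → Fin n → Subset (m G) → Set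
  IsNE r v T = ∀ i → (i ∈ T ⇔ DistSetLe (edge G i) v (r ℕ.∸ 1))

  Move : Fin n → Fin n → Set
  Move x y = x ≡ y ⊎ ∃ λ i → x ∈ edge G i × y ∈ edge G i

  Captured : {c : ℕ} → (Fin c → Fin n) → Fin n → Set
  Captured cs r = ∃ λ j → cs j ≡ r

  -- CopsForce cs r : cops at cs, robber at r, cops to move, robber not
  -- yet caught; the cops can force a capture (least fixed point =
  -- attractor of the reachability game).
  data CopsForce {c : ℕ} : (Fin c → Fin n) → Fin n → Set where
    step : ∀ {cs r} (cs' : Fin c → Fin n) →
           (∀ j → Move (cs j) (cs' j)) →
           (Captured cs' r ⊎
             (∀ r' → Move r r' → Captured cs' r' ⊎ CopsForce cs' r')) →
           CopsForce cs r

  CopsWin : ℕ → Set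
  CopsWin c = ∃ λ (cs : Fin c → Fin n) → ∀ r → Captured cs r ⊎ CopsForce cs r

ℕ→ℚ : ℕ → ℚ
ℕ→ℚ a = (+ a) / 1

_^ℚ_ : ℚ → ℕ → ℚ
q ^ℚ zero  = 1ℚ
q ^ℚ suc r = q ^ℚ r ℚ.* q

expTerm : ℚ → ℕ → ℚ
expTerm q zero    = 1ℚ
expTerm q (suc i) = expTerm q i ℚ.* q ℚ.* ((+ 1) / suc i)

expPartial : ℚ → ℕ → ℚ
expPartial q zero    = 0ℚ
expPartial q (suc N) = expPartial q N ℚ.+ expTerm q N

module _ {k n : ℕ} (G : KGraph k n) where

  IsN1 : (Fin n → Subset n) → Set
  IsN1 N1 = ∀ v → IsNV G 1 ⁅ v ⁆ (N1 v)

  sumℕ : ∀ {a} → (Fin a → ℕ) → ℕ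
  sumℕ {zero}  f = 0
  sumℕ {suc a} f = f Fin.zero ℕ.+ sumℕ (λ i → f (Fin.suc i))
    where import Data.Fin as Fin

  avgDeg : (N1 : Fin n → Subset n) → .{{_ : ℕ.NonZero n}} → ℚ
  avgDeg N1 = (+ sumℕ (λ v → ∣ N1 v ∣)) / n

  -- ξ-expanding with d = d(G); d ≥ k and 0 < ξ ≤ 1 are part of it.
  Expanding : (ξ d : ℚ) → Set
  Expanding ξ d =
      ℕ→ℚ k ℚ.≤ d × 0ℚ ℚ.< ξ × ξ ℚ.≤ 1ℚ
    -- (A.1)  d^r ≤ √(nk)  ⟺  d^(2r) ≤ nk  (d ≥ 0)
    × (∀ v r (T : Subset (m G)) → 1 ≤ r → IsNE G r v T →
         d ^ℚ (r ℕ.+ r) ℚ.≤ ℕ→ℚ (n ℕ.* k) →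
         ξ ℚ.* ℕ→ℚ ∣ T ∣ ℚ.* ℕ→ℚ k ℚ.≤ d ^ℚ r)
    × (∀ (A : Subset n) r (S : Subset n) → 1 ≤ r → IsNV G r A S →
         (ξ ℚ.* (ℕ→ℚ ∣ A ∣ ℚ.* d ^ℚ r ℚ.⊓ ℕ→ℚ n) ℚ.≤ ℕ→ℚ ∣ S ∣)
       × (ξ ℚ.* ℕ→ℚ ∣ S ∣ ℚ.≤ ℕ→ℚ ∣ A ∣ ℚ.* d ^ℚ r))
    × (∀ (B : Subset (m G)) (W : Subset n) r (S : Subset n) → 1 ≤ r →
         IsVB G B W → IsNV G r W S →
         ξ ℚ.* (ℕ→ℚ ∣ B ∣ ℚ.* ℕ→ℚ k ℚ.* d ^ℚ r ℚ.⊓ ℕ→ℚ n) ℚ.≤ ℕ→ℚ ∣ S ∣)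

-- "c ≤ 20 ξ^{-2} √(n/k) ln n", for c, n, k ∈ ℕ, n,k ≥ 1, rational ξ > 0.
-- With a = c ξ²/20 this reads a ≤ √(n/k)·ln n, i.e. √(a² k / n) ≤ ln n,
-- i.e. exp q ≤ n for every rational q ≥ 0 with q² n ≤ a² k, i.e. every
-- Taylor partial sum of exp q is ≤ n.
BoundHolds : (c n k : ℕ) (ξ : ℚ) → Set
BoundHolds c n k ξ =
  ∀ (q : ℚ) → 0ℚ ℚ.≤ q →
    q ℚ.* q ℚ.* ℕ→ℚ n ℚ.* ℕ→ℚ 400 ℚ.≤ (ℕ→ℚ c ℚ.* ξ ℚ.* ξ) ^ℚ 2 ℚ.* ℕ→ℚ k →
    ∀ N → expPartial q N ℚ.≤ ℕ→ℚ n

{-# OPTIONS --safe #-}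
module Submission where

-- Let s = ⌊ξ²√(nk)⌋ and let r be maximal with d^r ≤ √(nk). If the robber
-- starts at v, the cops have r rounds to get into position. When
-- d^r ≥ √(n/k) they guard every edge of N_E^r(v), using (A.1) and (A.3);
-- otherwise they guard every vertex of N_V^r(v), using (A.2). In both cases
-- expansion gives, for every set B of targets, at least s |B| vertices from
-- which a cop can reach a member of B in time. By Hall's theorem the targets
-- then own pairwise disjoint blocks of s such vertices, and a set of cops
-- meeting every block wins from v. A greedy choice meets all (at most n²)
-- blocks over all v with c + 1 cops, where n² (1 − s/n)^c ≥ 1, and this
-- inequality bounds c. If s ≤ 1, then n cops are few enough.

-- Disjoint blocks of size s for all targets must fit into n vertices, so about √(n/k) targets are
-- affordable, and each must be reachable from about √(nk) vertices. A ball of radius r may hold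
-- √(nk) vertices, too many by a factor k. The edges near it are fewer by that factor, because one
-- cop on an edge threatens all of it. When the ball is small, its vertices fit the budget, but
-- edges would expand too little; a vertex target gains one more step of expansion, because a cop
-- need only stand next to it. Both accounts balance at d^r = √(n/k). One factor ξ in s pays for the
-- upper bound on the number of targets, the other for the lower bound in the expansion. The
-- constant 20 leaves room: log(n²) costs a factor 2, and bounding s + 1 by 2s and c + 1 by 2c costs
-- 2 each, 8 in all. No square root or logarithm is ever formed: inequalities are squared, and log n
-- enters through Taylor sums of exp that stay below n.

open import Defs

-- Hall's theorem with demands, and greedy hitting sets.

module Combinatorics where

  open import Data.Nat using (ℕ; zero; suc; _+_; _*_; _∸_; _^_; _⊔_; _≤_; _<_; z≤n; s≤s; s≤s⁻¹; NonZero; >-nonZero)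
  open import Data.Nat.Properties hiding (_≟_)
  open import Data.Nat.Induction using (<-wellFounded)
  open import Induction.WellFounded using (Acc; acc)
  open import Algebra.Properties.Semiring.Sum +-*-semiring using (sum; sum-cong-≗; sum-replicate-zero; ∑-distrib-+)
  open import Data.Bool using (Bool; true; false; _∧_; _∨_; if_then_else_)
  open import Data.Fin using (Fin; zero; suc)
  import Data.Fin.Properties as Fin
  open import Data.Fin.Subset using (Subset; _∈_; _⊆_; ∣_∣; ⁅_⁆; _∩_; _∪_; _-_; Nonempty)
  open import Data.Fin.Subset.Properties using (_∈?_; nonempty?; anySubset?; p∩q⊆p; p∩q⊆q; x∈p∩q⁺; x∈p∩q⁻; x∈p∪q⁻; x∈⁅x⁆; p─q⊆p; x∈p⇒∣p-x∣<∣p∣; x∈p∧x≢y⇒x∈p-y; p⊂q⇒∣p∣<∣q∣)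
  open import Data.Vec using ([]; _∷_; lookup; tabulate)
  open import Data.Vec.Properties using (lookup-zipWith; lookup∘tabulate; []=⇒lookup; lookup⇒[]=)
  open import Data.List using (List; []; _∷_; length; filter)
  open import Data.List.Properties using (length-filter)
  open import Data.List.Relation.Unary.All as All using (All; []; _∷_)
  import Data.List.Relation.Unary.All.Properties as All
  open import Data.Maybe using (Maybe; just; nothing)
  open import Data.Product using (∃; _×_; _,_; proj₁; proj₂)
  open import Data.Sum using (inj₁; inj₂)
  open import Function using (_∘_)
  open import Relation.Nullary using (Dec; yes; no; does; contradiction; ¬?)
  open import Relation.Nullary.Decidable using (dec-true; _×-dec_)
  open import Relation.Unary using (Decidable)
  open import Relation.Binary.PropositionalEquality

  𝟙 : Bool → ℕ
  𝟙 b = if b then 1 else 0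

  𝟙≤1 : ∀ b → 𝟙 b ≤ 1
  𝟙≤1 true  = ≤-refl
  𝟙≤1 false = z≤n

  𝟙-mono : ∀ {a b} {P : Set a} {Q : Set b} (P? : Dec P) (Q? : Dec Q) →
           (P → Q) → 𝟙 (does P?) ≤ 𝟙 (does Q?)
  𝟙-mono (no _)  _       _ = z≤n
  𝟙-mono (yes _) (yes _) _ = ≤-refl
  𝟙-mono (yes p) (no ¬q) f = contradiction (f p) ¬q

  sum-mono : ∀ {n} {f g : Fin n → ℕ} → (∀ i → f i ≤ g i) → sum f ≤ sum g
  sum-mono {zero}  f≤g = z≤n
  sum-mono {suc n} f≤g = +-mono-≤ (f≤g zero) (sum-mono (f≤g ∘ suc))

  ∣∣≡sum : ∀ {n} (p : Subset n) → ∣ p ∣ ≡ sum (𝟙 ∘ lookup p)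
  ∣∣≡sum []          = refl
  ∣∣≡sum (true ∷ p)  = cong suc (∣∣≡sum p)
  ∣∣≡sum (false ∷ p) = ∣∣≡sum p

  lookup-∈? : ∀ {n} (p : Subset n) x → lookup p x ≡ does (x ∈? p)
  lookup-∈? p x with lookup p x in eq | x ∈? p
  ... | true  | yes _   = refl
  ... | false | no  _   = refl
  ... | true  | no  x∉p = contradiction (lookup⇒[]= x p eq) x∉p
  ... | false | yes x∈p = trans (sym eq) ([]=⇒lookup x∈p)

  module _ {n ℓ} {P : Fin n → Set ℓ} (P? : Decidable P) where

    toSubset : Subset n
    toSubset = tabulate (does ∘ P?)

    ∈-toSubset⁺ : ∀ {x} → P x → x ∈ toSubset
    ∈-toSubset⁺ {x} px =
      lookup⇒[]= x toSubset (trans (lookup∘tabulate _ x) (dec-true (P? x) px))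

    ∈-toSubset⁻ : ∀ {x} → x ∈ toSubset → P x
    ∈-toSubset⁻ {x} x∈ with P? x | trans (sym (lookup∘tabulate (does ∘ P?) x)) ([]=⇒lookup x∈)
    ... | yes px | _ = px

    ∣toSubset∣ : ∣ toSubset ∣ ≡ sum (𝟙 ∘ does ∘ P?)
    ∣toSubset∣ = trans (∣∣≡sum toSubset) (sum-cong-≗ (cong 𝟙 ∘ lookup∘tabulate (does ∘ P?)))

  module _ {τ : ℕ} where

    meets : Subset τ → Subset τ → ℕ
    meets ℓ B = 𝟙 (does (nonempty? (ℓ ∩ B)))

    -- With `L x` the targets adjacent to the vertex `x`, this is the size of the neighbourhood of
    -- `B`; Hall's condition compares it with the total demand `weight w B`.
    cover : ∀ {n} → (Fin n → Subset τ) → Subset τ → ℕ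
    cover L B = sum (λ x → meets (L x) B)

    weight : (Fin τ → ℕ) → Subset τ → ℕ
    weight w B = sum (λ e → 𝟙 (lookup B e) * w e)

    meets≤1 : ∀ ℓ B → meets ℓ B ≤ 1
    meets≤1 ℓ B = 𝟙≤1 (does (nonempty? (ℓ ∩ B)))

    meets-mono : ∀ ℓ {B C} → B ⊆ C → meets ℓ B ≤ meets ℓ C
    meets-mono ℓ {B} {C} B⊆C = 𝟙-mono (nonempty? (ℓ ∩ B)) (nonempty? (ℓ ∩ C))
      λ (e , e∈) → let (e∈ℓ , e∈B) = x∈p∩q⁻ ℓ B e∈ in e , x∈p∩q⁺ (e∈ℓ , B⊆C e∈B)

    -- If `ℓ` meets both sets, the right side is already 2. If it misses one of them, the
    -- intersection contributes nothing and the union no more than the other set. Summed over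
    -- vertices, this makes `cover` submodular.
    meets-submodular : ∀ ℓ B C →
      meets ℓ (B ∪ C) + meets ℓ (B ∩ C) ≤ meets ℓ B + meets ℓ C
    meets-submodular ℓ B C with nonempty? (ℓ ∩ B) in eqB | nonempty? (ℓ ∩ C) in eqC
    ... | yes _ | yes _ = +-mono-≤ (meets≤1 ℓ (B ∪ C)) (meets≤1 ℓ (B ∩ C))
    ... | no ¬B | c? = subst₂ _≤_ (+-comm (meets ℓ (B ∩ C)) _) refl
        (+-mono-≤ (≤-trans (meets-mono ℓ (p∩q⊆p B C)) (≤-reflexive (cong (𝟙 ∘ does) eqB)))
          (≤-trans (𝟙-mono (nonempty? (ℓ ∩ (B ∪ C))) (nonempty? (ℓ ∩ C)) to)
                   (≤-reflexive (cong (𝟙 ∘ does) eqC))))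
      where
      to : Nonempty (ℓ ∩ (B ∪ C)) → Nonempty (ℓ ∩ C)
      to (e , e∈) with x∈p∩q⁻ ℓ (B ∪ C) e∈
      ... | e∈ℓ , e∈∪ with x∈p∪q⁻ B C e∈∪
      ... | inj₁ e∈B = contradiction (e , x∈p∩q⁺ (e∈ℓ , e∈B)) ¬B
      ... | inj₂ e∈C = e , x∈p∩q⁺ (e∈ℓ , e∈C)
    ... | yes B≢∅ | no ¬C =
        +-mono-≤ (meets≤1 ℓ (B ∪ C))
          (≤-trans (meets-mono ℓ (p∩q⊆q B C)) (≤-reflexive (cong (𝟙 ∘ does) eqC)))

    cover-submodular : ∀ {n} (L : Fin n → Subset τ) B C →
      cover L (B ∪ C) + cover L (B ∩ C) ≤ cover L B + cover L C
    cover-submodular L B C = subst₂ _≤_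
      (∑-distrib-+ (λ x → meets (L x) (B ∪ C)) (λ x → meets (L x) (B ∩ C)))
      (∑-distrib-+ (λ x → meets (L x) B) (λ x → meets (L x) C))
      (sum-mono λ x → meets-submodular (L x) B C)

    weight-modular : ∀ w B C → weight w (B ∪ C) + weight w (B ∩ C) ≡ weight w B + weight w C
    weight-modular w B C = trans (sym (∑-distrib-+ (term (B ∪ C)) (term (B ∩ C))))
      (trans (sum-cong-≗ pointwise) (∑-distrib-+ (term B) (term C)))
      where
      term : Subset τ → Fin τ → ℕ
      term D e = 𝟙 (lookup D e) * w e
      ∨∧ : ∀ a b m → 𝟙 (a ∨ b) * m + 𝟙 (a ∧ b) * m ≡ 𝟙 a * m + 𝟙 b * m
      ∨∧ true  true  m = refl
      ∨∧ true  false m = refl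
      ∨∧ false true  m = +-comm (1 * m) 0
      ∨∧ false false m = refl
      pointwise : ∀ e → term (B ∪ C) e + term (B ∩ C) e ≡ term B e + term C e
      pointwise e rewrite lookup-zipWith _∨_ e B C | lookup-zipWith _∧_ e B C =
        ∨∧ (lookup B e) (lookup C e) (w e)

    weight-unit : ∀ B e → weight (λ e′ → 𝟙 (does (e Fin.≟ e′))) B ≡ 𝟙 (lookup B e)
    weight-unit = go
      where
      go : ∀ {τ} (B : Subset τ) e →
           sum (λ e′ → 𝟙 (lookup B e′) * 𝟙 (does (e Fin.≟ e′))) ≡ 𝟙 (lookup B e)
      go {suc τ} (b ∷ B) zero    = begin-equality
        𝟙 b * 1 + sum (λ e → 𝟙 (lookup B e) * 0)
          ≡⟨ cong₂ _+_ (*-identityʳ (𝟙 b)) (sum-cong-≗ λ e → *-zeroʳ (𝟙 (lookup B e))) ⟩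
        𝟙 b + sum {τ} (λ _ → 0)
          ≡⟨ cong (𝟙 b +_) (sum-replicate-zero τ) ⟩
        𝟙 b + 0
          ≡⟨ +-identityʳ (𝟙 b) ⟩
        𝟙 b ∎
        where open ≤-Reasoning
      go (b ∷ B) (suc e) = cong₂ _+_ (*-zeroʳ (𝟙 b)) (go B e)

    assigned : Maybe (Fin τ) → Fin τ → Bool
    assigned nothing   e  = false
    assigned (just e′) e  = does (e′ Fin.≟ e)

    minimal-subset : ∀ {p} {P : Subset τ → Set p} → Decidable P → ∃ P →
      ∃ λ B₀ → P B₀ × (∀ B → P B → ∣ B₀ ∣ ≤ ∣ B ∣)
    minimal-subset {P = P} P? (B , PB) = go B PB (<-wellFounded ∣ B ∣)
      where
      go : ∀ B → P B → Acc _<_ ∣ B ∣ → ∃ λ B₀ → P B₀ × (∀ B → P B → ∣ B₀ ∣ ≤ ∣ B ∣)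
      go B PB (acc rs) with anySubset? (λ C → P? C ×-dec (∣ C ∣ <? ∣ B ∣))
      ... | yes (C , PC , C<B) = go C PC (rs C<B)
      ... | no  none           = B , PB , λ C PC → ≮⇒≥ λ C<B → none (C , PC , C<B)

    ∣p∣≤∣p∩q∣⇒p⊆q : ∀ (p q : Subset τ) → ∣ p ∣ ≤ ∣ p ∩ q ∣ → p ⊆ q
    ∣p∣≤∣p∩q∣⇒p⊆q p q p≤ {x} x∈p with x ∈? q
    ... | yes x∈q = x∈q
    ... | no  x∉q = contradiction
      (p⊂q⇒∣p∣<∣q∣ (p∩q⊆p p q , x , x∈p , x∉q ∘ proj₂ ∘ x∈p∩q⁻ p q)) (≤⇒≯ p≤)

    module _ {n} (L : Fin (suc n) → Subset τ) (w : Fin τ → ℕ)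
             (hall : ∀ B → weight w B ≤ cover L B) where

      private
        L′ : Fin n → Subset τ
        L′ = L ∘ suc

        Deficient : Subset τ → Set
        Deficient B = cover L′ B < weight w B

        weight≤ : ∀ B → weight w B ≤ suc (cover L′ B)
        weight≤ B = ≤-trans (hall B) (+-monoˡ-≤ (cover L′ B) (meets≤1 (L zero) B))

      -- Call `weight w` minus `cover L′` the excess. It is supermodular, and losing a single vertex
      -- keeps it at most 1 everywhere. Two deficient sets have excess at least 1 each; their union
      -- takes at most 1 of the total, so at least 1 is left for the intersection.
      deficient-∩ : ∀ {B C} → Deficient B → Deficient C → Deficient (B ∩ C)
      deficient-∩ {B} {C} dB dC = +-cancelˡ-≤ (suc (cover L′ (B ∪ C))) _ _ (begin
        suc (cover L′ (B ∪ C)) + suc (cover L′ (B ∩ C))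
          ≡⟨ cong suc (+-suc _ _) ⟩
        2 + (cover L′ (B ∪ C) + cover L′ (B ∩ C))
          ≤⟨ +-monoʳ-≤ 2 (cover-submodular L′ B C) ⟩
        2 + (cover L′ B + cover L′ C)
          ≡⟨ cong suc (+-suc _ _) ⟨
        suc (cover L′ B) + suc (cover L′ C)
          ≤⟨ +-mono-≤ dB dC ⟩
        weight w B + weight w C
          ≡⟨ weight-modular w B C ⟨
        weight w (B ∪ C) + weight w (B ∩ C)
          ≤⟨ +-monoˡ-≤ _ (weight≤ (B ∪ C)) ⟩
        suc (cover L′ (B ∪ C)) + weight w (B ∩ C) ∎)
        where open ≤-Reasoning

      weight-remove : ∀ B e → w e ≡ 0 → weight w B ≤ weight w (B - e)
      weight-remove B e we≡0 = sum-mono pointwise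
        where
        open ≤-Reasoning
        pointwise : ∀ x → 𝟙 (lookup B x) * w x ≤ 𝟙 (lookup (B - e) x) * w x
        pointwise x with x Fin.≟ e
        ... | yes refl rewrite we≡0 | *-zeroʳ (𝟙 (lookup B e)) = z≤n
        ... | no  x≢e  = *-monoˡ-≤ (w x) (begin
          𝟙 (lookup B x)            ≡⟨ cong 𝟙 (lookup-∈? B x) ⟩
          𝟙 (does (x ∈? B))         ≤⟨ 𝟙-mono (x ∈? B) (x ∈? (B - e)) (λ x∈B → x∈p∧x≢y⇒x∈p-y x∈B x≢e) ⟩
          𝟙 (does (x ∈? (B - e)))   ≡⟨ cong 𝟙 (lookup-∈? (B - e) x) ⟨
          𝟙 (lookup (B - e) x)      ∎)

      -- A deficient set of minimum size lies inside every deficient set, so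
      -- giving the first vertex to one of its members repairs all of them.
      hall-step : ∃ (λ B → Deficient B) → ∃ λ e → e ∈ L zero × ∃ λ w′ →
        (∀ e′ → w e′ ≡ w′ e′ + 𝟙 (does (e Fin.≟ e′))) ×
        (∀ B → weight w′ B ≤ cover L′ B)
      hall-step someDeficient
        with minimal-subset (λ B → cover L′ B <? weight w B) someDeficient
      ... | B₀ , d₀ , B₀-min with nonempty? (L zero ∩ B₀) | hall B₀
      ... | no  _ | wB₀≤ = contradiction wB₀≤ (<⇒≱ d₀)
      ... | yes (e , e∈) | _ = e , proj₁ (x∈p∩q⁻ (L zero) B₀ e∈) , w′ , w≡w′+ , hall′
        where
        e∈B₀ : e ∈ B₀
        e∈B₀ = proj₂ (x∈p∩q⁻ (L zero) B₀ e∈)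

        -- Were the demand of `e` zero, removing `e` from `B₀` would leave a smaller deficient set.
        1≤we : 1 ≤ w e
        1≤we = n≢0⇒n>0 λ we≡0 → <⇒≱ (x∈p⇒∣p-x∣<∣p∣ e∈B₀) (B₀-min (B₀ - e)
          (≤-<-trans (sum-mono λ x → meets-mono (L′ x) (p─q⊆p B₀ ⁅ e ⁆))
            (<-≤-trans d₀ (weight-remove B₀ e we≡0))))

        w′ : Fin τ → ℕ
        w′ e′ = w e′ ∸ 𝟙 (does (e Fin.≟ e′))

        w≡w′+ : ∀ e′ → w e′ ≡ w′ e′ + 𝟙 (does (e Fin.≟ e′))
        w≡w′+ e′ = sym (m∸n+n≡m unit≤)
          where
          unit≤ : 𝟙 (does (e Fin.≟ e′)) ≤ w e′
          unit≤ with e Fin.≟ e′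
          ... | yes refl = 1≤we
          ... | no  _    = z≤n

        weight-split : ∀ B → weight w B ≡ weight w′ B + 𝟙 (lookup B e)
        weight-split B = begin-equality
          weight w B
            ≡⟨ sum-cong-≗ (λ e′ → trans (cong (𝟙 (lookup B e′) *_) (w≡w′+ e′))
                                         (*-distribˡ-+ (𝟙 (lookup B e′)) (w′ e′) _)) ⟩
          sum (λ e′ → 𝟙 (lookup B e′) * w′ e′ + 𝟙 (lookup B e′) * 𝟙 (does (e Fin.≟ e′)))
            ≡⟨ ∑-distrib-+ (λ e′ → 𝟙 (lookup B e′) * w′ e′) _ ⟩
          weight w′ B + weight (λ e′ → 𝟙 (does (e Fin.≟ e′))) B
            ≡⟨ cong (weight w′ B +_) (weight-unit B e) ⟩
          weight w′ B + 𝟙 (lookup B e) ∎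
          where open ≤-Reasoning

        hall′ : ∀ B → weight w′ B ≤ cover L′ B
        hall′ B with cover L′ B <? weight w B
        ... | no ¬dB = ≤-trans (m≤m+n _ _) (≤-trans (≤-reflexive (sym (weight-split B))) (≮⇒≥ ¬dB))
        ... | yes dB = s≤s⁻¹ (≤-trans (≤-reflexive (trans (+-comm 1 _) (sym
            (trans (weight-split B) (cong (λ b → weight w′ B + 𝟙 b) ([]=⇒lookup e∈B)))))) (weight≤ B))
          where
          e∈B : e ∈ B
          e∈B = ∣p∣≤∣p∩q∣⇒p⊆q B₀ B (B₀-min (B₀ ∩ B) (deficient-∩ d₀ dB)) e∈B₀

    -- Induction on the vertices. The first vertex stays unassigned if Hall's condition survives its
    -- removal; otherwise `hall-step` names a target for it and lowers that target's demand by one.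
    hall-demands : ∀ {n} (L : Fin n → Subset τ) (w : Fin τ → ℕ) →
      (∀ B → weight w B ≤ cover L B) →
      ∃ λ (β : Fin n → Maybe (Fin τ)) →
        (∀ x {e} → β x ≡ just e → e ∈ L x) ×
        (∀ e → w e ≤ sum (λ x → 𝟙 (assigned (β x) e)))
    -- With no vertices left, Hall's condition for singletons forces every demand to be zero.
    hall-demands {zero} L w hall = (λ ()) , (λ ()) , λ e → begin
      w e                            ≡⟨ *-identityˡ (w e) ⟨
      1 * w e                        ≡⟨ cong (λ b → 𝟙 b * w e) ([]=⇒lookup (x∈⁅x⁆ e)) ⟨
      𝟙 (lookup ⁅ e ⁆ e) * w e       ≤⟨ term≤sum (λ e′ → 𝟙 (lookup ⁅ e ⁆ e′) * w e′) e ⟩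
      weight w ⁅ e ⁆                 ≤⟨ hall ⁅ e ⁆ ⟩
      0                              ∎
      where
      open ≤-Reasoning
      term≤sum : ∀ {n} (f : Fin n → ℕ) i → f i ≤ sum f
      term≤sum f zero    = m≤m+n _ _
      term≤sum f (suc i) = ≤-trans (term≤sum (f ∘ suc) i) (m≤n+m _ _)
    hall-demands {suc n} L w hall with anySubset? (λ B → cover (L ∘ suc) B <? weight w B)
    ... | no none with hall-demands (L ∘ suc) w (λ B → ≮⇒≥ λ dB → none (B , dB))
    ... | β , β∈ , w≤ = (λ { zero → nothing ; (suc x) → β x })
                      , (λ { zero () ; (suc x) eq → β∈ x eq })
                      , w≤
    hall-demands {suc n} L w hall | yes some with hall-step L w hall some
    ... | e , e∈L₀ , w′ , w≡ , hall′ with hall-demands (L ∘ suc) w′ hall′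
    ... | β , β∈ , w′≤ = (λ { zero → just e ; (suc x) → β x })
                       , (λ { zero refl → e∈L₀ ; (suc x) eq → β∈ x eq })
                       , λ e′ → ≤-trans (≤-reflexive (trans (w≡ e′) (+-comm (w′ e′) _)))
                                        (+-monoʳ-≤ (𝟙 (does (e Fin.≟ e′))) (w′≤ e′))

  exists-≥-average : ∀ {n} .{{_ : NonZero n}} (f : Fin n → ℕ) → ∃ λ x → sum f ≤ n * f x
  exists-≥-average {suc zero}    f = zero , ≤-refl
  exists-≥-average {suc (suc n)} f with exists-≥-average (f ∘ suc)
  ... | x , sum≤ with ≤-total (f zero) (f (suc x))
  ... | inj₁ f0≤ = suc x , +-mono-≤ f0≤ sum≤
  ... | inj₂ f0≥ = zero , +-monoʳ-≤ (f zero) (≤-trans sum≤ (*-monoʳ-≤ (suc n) f0≥))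

  module _ {n : ℕ} where

    hits : List (Subset n) → Fin n → ℕ
    hits []       x = 0
    hits (F ∷ Fs) x = 𝟙 (lookup F x) + hits Fs x

    Σhits≥ : ∀ {s} Fs → All (λ F → s ≤ ∣ F ∣) Fs → s * length Fs ≤ sum (hits Fs)
    Σhits≥ {s} []       []         = ≤-trans (≤-reflexive (*-zeroʳ s)) z≤n
    Σhits≥ {s} (F ∷ Fs) (s≤F ∷ s≤) = begin
      s * suc (length Fs)                    ≡⟨ *-suc s _ ⟩
      s + s * length Fs                      ≤⟨ +-mono-≤ s≤F (Σhits≥ Fs s≤) ⟩
      ∣ F ∣ + sum (hits Fs)                  ≡⟨ cong (_+ sum (hits Fs)) (∣∣≡sum F) ⟩
      sum (𝟙 ∘ lookup F) + sum (hits Fs)     ≡⟨ ∑-distrib-+ (𝟙 ∘ lookup F) (hits Fs) ⟨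
      sum (hits (F ∷ Fs))                    ∎
      where open ≤-Reasoning

    unhit : Fin n → List (Subset n) → List (Subset n)
    unhit x = filter (λ F → ¬? (x ∈? F))

    hits+unhit : ∀ x Fs → hits Fs x + length (unhit x Fs) ≡ length Fs
    hits+unhit x [] = refl
    hits+unhit x (F ∷ Fs) rewrite lookup-∈? F x with x ∈? F
    ... | yes _ = cong suc (hits+unhit x Fs)
    ... | no  _ = trans (+-suc (hits Fs x) _) (cong suc (hits+unhit x Fs))

    All-unhit⁻ : ∀ {q} {Q : Subset n → Set q} x Fs → (∀ {F} → x ∈ F → Q F) →
                 All Q (unhit x Fs) → All Q Fs
    All-unhit⁻ x []       hit qs = []
    All-unhit⁻ x (F ∷ Fs) hit qs with x ∈? F
    All-unhit⁻ x (F ∷ Fs) hit qs       | yes x∈F = hit x∈F ∷ All-unhit⁻ x Fs hit qs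
    All-unhit⁻ x (F ∷ Fs) hit (q ∷ qs) | no  _   = q ∷ All-unhit⁻ x Fs hit qs

    module _ .{{_ : NonZero n}} {s : ℕ} (1≤s : 1 ≤ s) (s≤n : s ≤ n) where

      -- Double counting: there are at least `s * length Fs` incidences, so an average vertex lies
      -- in a fraction s/n of the sets.
      unhit-shrinks : ∀ Fs → All (λ F → s ≤ ∣ F ∣) Fs →
        ∃ λ x → n * length (unhit x Fs) ≤ (n ∸ s) * length Fs
      unhit-shrinks Fs big with exists-≥-average (hits Fs)
      ... | x , avg = x , +-cancelˡ-≤ (s * length Fs) _ _ (begin
        s * length Fs + n * length (unhit x Fs)
          ≤⟨ +-monoˡ-≤ _ (≤-trans (Σhits≥ Fs big) avg) ⟩
        n * hits Fs x + n * length (unhit x Fs)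
          ≡⟨ *-distribˡ-+ n (hits Fs x) _ ⟨
        n * (hits Fs x + length (unhit x Fs))
          ≡⟨ cong (n *_) (hits+unhit x Fs) ⟩
        n * length Fs
          ≡⟨ cong (_* length Fs) (m+[n∸m]≡n s≤n) ⟨
        (s + (n ∸ s)) * length Fs
          ≡⟨ *-distribʳ-+ (length Fs) s _ ⟩
        s * length Fs + (n ∸ s) * length Fs ∎)
        where open ≤-Reasoning

      -- The inequality describes the moment before the last choice: `c` choices, each keeping at
      -- most a fraction 1 - s/n, have left at least one set. Hence the exponent `c` for `suc c`
      -- points. The maximum with 1 covers the empty family.
      greedy-hitting-set : ∀ Fs → All (λ F → s ≤ ∣ F ∣) Fs →
        ∃ λ c → n ^ c ≤ (1 ⊔ length Fs) * (n ∸ s) ^ c ×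
        ∃ λ (cs : Fin (suc c) → Fin n) → All (λ F → ∃ λ j → cs j ∈ F) Fs
      greedy-hitting-set Fs big = go Fs big (<-wellFounded (length Fs))
        where
        open ≤-Reasoning
        go : ∀ Fs → All (λ F → s ≤ ∣ F ∣) Fs → Acc _<_ (length Fs) →
          ∃ λ c → n ^ c ≤ (1 ⊔ length Fs) * (n ∸ s) ^ c ×
          ∃ λ (cs : Fin (suc c) → Fin n) → All (λ F → ∃ λ j → cs j ∈ F) Fs
        go Fs big (acc rs) with unhit-shrinks Fs big
        ... | x , shrink with unhit x Fs in eq
        ... | [] = 0 , ≤-trans (m≤m⊔n 1 (length Fs)) (≤-reflexive (sym (*-identityʳ _)))
                 , (λ _ → x) , All-unhit⁻ x Fs (zero ,_) (subst (All _) (sym eq) [])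
        ... | Gs@(_ ∷ _)
            with go Gs (subst (All _) eq (All.filter⁺ (λ F → ¬? (x ∈? F)) big)) (rs shorter)
          where
          len>0 : 0 < length Fs
          len>0 = ≤-trans (s≤s z≤n) (≤-trans (≤-reflexive (cong length (sym eq)))
                    (length-filter (λ F → ¬? (x ∈? F)) Fs))
          shorter : length Gs < length Fs
          shorter = *-cancelˡ-< n _ _ (≤-<-trans shrink
            (*-monoˡ-< (length Fs) {{>-nonZero len>0}} (∸-monoʳ-< 1≤s s≤n)))
        ... | c , n^c≤ , cs , hit =
            suc c
          , (begin
              n * n ^ c                                    ≤⟨ *-monoʳ-≤ n n^c≤ ⟩
              -- `Gs` is a cons, so `1 ⊔ length Gs` reduces to `length Gs`.
              n * ((1 ⊔ length Gs) * (n ∸ s) ^ c)          ≡⟨ *-assoc n (length Gs) _ ⟨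
              n * length Gs * (n ∸ s) ^ c                  ≤⟨ *-monoˡ-≤ ((n ∸ s) ^ c) shrink ⟩
              (n ∸ s) * length Fs * (n ∸ s) ^ c            ≡⟨ cong (_* (n ∸ s) ^ c) (*-comm (n ∸ s) (length Fs)) ⟩
              length Fs * (n ∸ s) * (n ∸ s) ^ c            ≡⟨ *-assoc (length Fs) _ _ ⟩
              length Fs * (n ∸ s) ^ suc c                  ≤⟨ *-monoˡ-≤ ((n ∸ s) ^ suc c) (m≤n⊔m 1 (length Fs)) ⟩
              (1 ⊔ length Fs) * (n ∸ s) ^ suc c            ∎)
          , (λ { zero → x ; (suc j) → cs j })
          , All-unhit⁻ x Fs (zero ,_) (subst (All _) (sym eq) (All.map (λ (j , h) → suc j , h) hit))

-- The game: walks, guarded targets, and a starting position good against every robber.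

module Pursuit where

  open Combinatorics
  open import Data.Nat using (ℕ; zero; suc; _+_; _*_; _∸_; _^_; _≤_; z≤n; s≤s; NonZero; >-nonZero⁻¹)
  open import Data.Nat.Properties hiding (_≟_)
  open import Algebra.Properties.Semiring.Sum +-*-semiring using (sum; sum-cong-≗; *-distribˡ-sum)
  open import Data.Bool using (Bool; true; false; _∧_)
  open import Data.Fin using (Fin; zero; suc)
  import Data.Fin.Properties as Fin
  open import Data.Fin.Subset using (Subset; _∈_; _⊆_; ∣_∣; _∩_; Nonempty)
  open import Data.Fin.Subset.Properties using (_∈?_; nonempty?; p∩q⊆p; p∩q⊆q; x∈p∩q⁺)
  open import Data.Vec using (lookup)
  open import Data.Vec.Properties using (lookup-zipWith; []=⇒lookup)
  open import Data.List as List using (List; []; _∷_; length; filter; allFin; cartesianProductWith)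
  open import Data.List.Properties using (length-filter; length-tabulate; length-++; length-map)
  open import Data.List.Membership.Propositional.Properties using (∈-filter⁺; ∈-cartesianProductWith⁺; ∈-allFin)
  open import Data.List.Relation.Unary.All as All using (All)
  import Data.List.Relation.Unary.All.Properties as All
  open import Data.Maybe using (Maybe; just; nothing)
  import Data.Maybe.Properties as Maybe
  open import Data.Product using (∃; _×_; _,_; proj₁; proj₂)
  open import Data.Sum using (_⊎_; inj₁; inj₂)
  open import Function using (_∘_)
  open import Function.Bundles using (_⇔_; mk⇔)
  open import Relation.Nullary using (Dec; yes; no; does; contradiction)
  open import Relation.Nullary.Decidable using (dec-true; _×-dec_; _⊎-dec_)
  open import Relation.Unary using (Decidable)
  open import Relation.Binary.PropositionalEquality

  sum>0⇒∃ : ∀ {n} (f : Fin n → Bool) → 1 ≤ sum (𝟙 ∘ f) → ∃ λ x → f x ≡ true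
  sum>0⇒∃ {suc n} f 1≤ with f zero in eq
  ... | true  = zero , eq
  ... | false with sum>0⇒∃ (f ∘ suc) 1≤
  ... | x , fx = suc x , fx

  length-cartesianProductWith : ∀ {a b c} {A : Set a} {B : Set b} {C : Set c} (f : A → B → C) xs ys →
    length (cartesianProductWith f xs ys) ≡ length xs * length ys
  length-cartesianProductWith f []       ys = refl
  length-cartesianProductWith f (x ∷ xs) ys =
    trans (length-++ (List.map (f x) ys))
          (cong₂ _+_ (length-map (f x) ys) (length-cartesianProductWith f xs ys))

  module _ {k n : ℕ} (G : KGraph k n) where

    -- Staying put is a legal move, so walks of exactly `t` moves capture distance at most `t`, for
    -- the cops and the robber alike.
    Walk : ℕ → Fin n → Fin n → Set
    Walk zero    x z = x ≡ z
    Walk (suc t) x z = ∃ λ y → Move G x y × Walk t y z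

    Move? : ∀ x y → Dec (Move G x y)
    Move? x y = (x Fin.≟ y) ⊎-dec Fin.any? (λ i → (x ∈? edge G i) ×-dec (y ∈? edge G i))

    Walk? : ∀ t x z → Dec (Walk t x z)
    Walk? zero    x z = x Fin.≟ z
    Walk? (suc t) x z = Fin.any? (λ y → Move? x y ×-dec Walk? t y z)

    Move-sym : ∀ {x y} → Move G x y → Move G y x
    Move-sym (inj₁ refl)            = inj₁ refl
    Move-sym (inj₂ (i , x∈i , y∈i)) = inj₂ (i , y∈i , x∈i)

    Walk-refl : ∀ t {x} → Walk t x x
    Walk-refl zero    = refl
    Walk-refl (suc t) = _ , inj₁ refl , Walk-refl t

    snoc : ∀ t {x y z} → Walk t x y → Move G y z → Walk (suc t) x z
    snoc zero    refl         m  = _ , m , refl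
    snoc (suc t) (y , m′ , w) m  = y , m′ , snoc t w m

    unsnoc : ∀ t {x z} → Walk (suc t) x z → ∃ λ y → Walk t x y × Move G y z
    unsnoc zero    (_ , m , refl) = _ , refl , m
    unsnoc (suc t) (y , m , w) with unsnoc t w
    ... | y′ , w′ , m′ = y′ , (y , m , w′) , m′

    Walk-sym : ∀ t {x z} → Walk t x z → Walk t z x
    Walk-sym zero    refl        = refl
    Walk-sym (suc t) (y , m , w) = snoc t (Walk-sym t w) (Move-sym m)

    Chain⇒Walk : ∀ t {x z} → Chain G t x z → Walk (suc t) x z
    Chain⇒Walk zero    c                       = _ , inj₂ c , refl
    Chain⇒Walk (suc t) (i , x∈i , y , y∈i , c) = y , inj₂ (i , x∈i , y∈i) , Chain⇒Walk t c

    Walk-≤ : ∀ {t r x z} → t ≤ r → Walk t x z → Walk r x z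
    Walk-≤ {r = r} z≤n       refl        = Walk-refl r
    Walk-≤ (s≤s t≤r) (y , m , w) = y , m , Walk-≤ t≤r w

    DistLe⇒Walk : ∀ {r x z} → DistLe G x z r → Walk r x z
    DistLe⇒Walk {r} (inj₁ refl)           = Walk-refl r
    DistLe⇒Walk     (inj₂ (t , t<r , c))  = Walk-≤ t<r (Chain⇒Walk t c)

    Walk⇒DistLe : ∀ r {x z} → Walk r x z → DistLe G x z r
    Walk⇒DistLe zero    x≡z         = inj₁ x≡z
    Walk⇒DistLe (suc r) (y , m , w) with m | Walk⇒DistLe r w
    ... | inj₁ refl            | inj₁ x≡z           = inj₁ x≡z
    ... | inj₁ refl            | inj₂ (t , t<r , c) = inj₂ (t , m≤n⇒m≤1+n t<r , c)
    ... | inj₂ (i , x∈i , y∈i) | inj₁ refl          = inj₂ (0 , s≤s z≤n , i , x∈i , y∈i)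
    ... | inj₂ (i , x∈i , y∈i) | inj₂ (t , t<r , c) = inj₂ (suc t , s≤s t<r , i , x∈i , y , y∈i , c)

    -- Every cop walks to its own goal whatever the robber does. After `t` rounds the robber is at
    -- the end of some walk of length `t` from `v`, hence one move away from a cop. An earlier
    -- encounter may be ignored, since `CopsForce` can be derived at any position.
    march : ∀ t {c} {cs goal : Fin c → Fin n} {v} → (∀ j → Walk t (cs j) (goal j)) →
      (∀ {r} → Walk t v r → ∃ λ j → Move G (goal j) r) → Captured G cs v ⊎ CopsForce G cs v
    march zero {cs = cs} {goal} {v} go guard with guard refl
    ... | j , m = inj₂ (step cs′ legal (inj₁ (j , captures)))
      where
      cs′ : _ → Fin n
      cs′ i with i Fin.≟ j
      ... | yes _ = v
      ... | no  _ = cs i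
      legal : ∀ i → Move G (cs i) (cs′ i)
      legal i with i Fin.≟ j
      ... | yes refl = subst (λ x → Move G x v) (sym (go i)) m
      ... | no  _    = inj₁ refl
      captures : cs′ j ≡ v
      captures with j Fin.≟ j
      ... | yes _  = refl
      ... | no j≢j = contradiction refl j≢j
    march (suc t) go guard = inj₂ (step (proj₁ ∘ go) (proj₁ ∘ proj₂ ∘ go)
      (inj₂ λ r m → march t (proj₂ ∘ proj₂ ∘ go) (λ w → guard (r , m , w))))

    module _ (t : ℕ) {τ : ℕ} (T : Fin n → Subset τ)
             {Guard : Fin τ → Fin n → Set} (Guard? : ∀ e y → Dec (Guard e y)) where

      -- Targets and `Guard` stay abstract so that the same argument serves vertices and edges:
      -- `T v` collects the targets to be guarded against a robber starting at `v`, and `Guard e y`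
      -- says that a cop on `y` guards `e`.
      Reaches : Fin τ → Fin n → Set
      Reaches e x = ∃ λ y → Walk t x y × Guard e y

      Reaches? : ∀ e x → Dec (Reaches e x)
      Reaches? e x = Fin.any? (λ y → Walk? t x y ×-dec Guard? e y)

      module _ {s : ℕ}
        (expand : ∀ v B S → B ⊆ T v → (∀ x → (x ∈ S ⇔ ∃ λ e → e ∈ B × Reaches e x)) → s * ∣ B ∣ ≤ ∣ S ∣) where

        private
          row : Fin n → Subset τ
          row x = toSubset (λ e → Reaches? e x)

          -- Targets outside `T v` demand nothing, so Hall's condition for an arbitrary `B` reduces
          -- to the expansion of `B ∩ T v`.
          demand : Fin n → Fin τ → ℕ
          demand v e = s * 𝟙 (lookup (T v) e)

          weight-demand : ∀ v B → weight (demand v) B ≡ s * ∣ B ∩ T v ∣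
          weight-demand v B = begin
            weight (demand v) B                     ≡⟨ sum-cong-≗ pointwise ⟩
            sum (λ e → s * 𝟙 (lookup (B ∩ T v) e))  ≡⟨ *-distribˡ-sum s (𝟙 ∘ lookup (B ∩ T v)) ⟨
            s * sum (𝟙 ∘ lookup (B ∩ T v))          ≡⟨ cong (s *_) (∣∣≡sum (B ∩ T v)) ⟨
            s * ∣ B ∩ T v ∣                         ∎
            where
            open ≡-Reasoning
            ∧-* : ∀ a b → 𝟙 a * (s * 𝟙 b) ≡ s * 𝟙 (a ∧ b)
            ∧-* true  b = *-identityˡ (s * 𝟙 b)
            ∧-* false b = sym (*-zeroʳ s)
            pointwise : ∀ e → 𝟙 (lookup B e) * demand v e ≡ s * 𝟙 (lookup (B ∩ T v) e)
            pointwise e rewrite lookup-zipWith _∧_ e B (T v) = ∧-* (lookup B e) (lookup (T v) e)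

          hall : ∀ v B → weight (demand v) B ≤ cover row B
          hall v B = begin
            weight (demand v) B             ≡⟨ weight-demand v B ⟩
            s * ∣ B ∩ T v ∣                 ≤⟨ expand v (B ∩ T v) (toSubset reached?) (p∩q⊆q B (T v))
                                                (λ x → mk⇔ (∈-toSubset⁻ reached?) (∈-toSubset⁺ reached?)) ⟩
            ∣ toSubset reached? ∣           ≡⟨ ∣toSubset∣ reached? ⟩
            sum (𝟙 ∘ does ∘ reached?)       ≤⟨ sum-mono (λ x → 𝟙-mono (reached? x) (nonempty? (row x ∩ B)) meet) ⟩
            cover row B                     ∎
            where
            open ≤-Reasoning
            reached? : Decidable (λ x → ∃ λ e → e ∈ B ∩ T v × Reaches e x)
            reached? x = Fin.any? (λ e → (e ∈? (B ∩ T v)) ×-dec Reaches? e x)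
            meet : ∀ {x} → (∃ λ e → e ∈ B ∩ T v × Reaches e x) → Nonempty (row x ∩ B)
            meet {x} (e , e∈ , reach) =
              e , x∈p∩q⁺ (∈-toSubset⁺ (λ e → Reaches? e x) reach , p∩q⊆p B (T v) e∈)

        assignment : ∀ v → ∃ λ (β : Fin n → Maybe (Fin τ)) →
          (∀ x {e} → β x ≡ just e → Reaches e x) ×
          (∀ {e} → e ∈ T v → s ≤ sum (λ x → 𝟙 (assigned (β x) e)))
        assignment v with hall-demands row (demand v) (hall v)
        ... | β , β∈ , demand≤ = β
          , (λ x eq → ∈-toSubset⁻ (λ e → Reaches? e x) (β∈ x eq))
          , λ {e} e∈T → ≤-trans (≤-reflexive (trans (sym (*-identityʳ s))
                          (cong (λ b → s * 𝟙 b) (sym ([]=⇒lookup e∈T))))) (demand≤ e)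

      module _ {s : ℕ} (1≤s : 1 ≤ s) (s≤n : s ≤ n) .{{_ : NonZero n}}
        (β : Fin n → Fin n → Maybe (Fin τ))
        (β-reaches : ∀ v x {e} → β v x ≡ just e → Reaches e x)
        (β-demand : ∀ v {e} → e ∈ T v → s ≤ sum (λ x → 𝟙 (assigned (β v x) e)))
        (respond : ∀ {v r} → Walk t v r → ∃ λ e → e ∈ T v × (∀ {y} → Guard e y → Move G y r)) where

        private
          assigned⇒≡ : ∀ b {e : Fin τ} → assigned b e ≡ true → b ≡ just e
          assigned⇒≡ (just e′) {e} eq with e′ Fin.≟ e
          ... | yes refl = refl

          _≟_ : (a b : Maybe (Fin τ)) → Dec (a ≡ b)
          _≟_ = Maybe.≡-dec Fin._≟_

          -- Indexing a block by one of its members bounds the number of blocks by n².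
          block : Fin n → Fin n → Subset n
          block v x = toSubset (λ y → β v y ≟ β v x)

          candidates : List (Subset n)
          candidates = cartesianProductWith block (allFin n) (allFin n)

          -- Every target in `T v` owns at least `s` vertices, so the size filter keeps its block.
          -- The class of unassigned vertices may survive as well; hitting it does no harm.
          blocks : List (Subset n)
          blocks = filter (λ F → s ≤? ∣ F ∣) candidates

          length-blocks : length blocks ≤ n * n
          length-blocks = ≤-trans (length-filter (λ F → s ≤? ∣ F ∣) candidates) (≤-reflexive
            (trans (length-cartesianProductWith block (allFin n) (allFin n))
                   (cong₂ _*_ (length-tabulate {n = n} _) (length-tabulate {n = n} _))))

          hit-all : ∀ {c} {cs : Fin c → Fin n} → All (λ F → ∃ λ j → cs j ∈ F) blocks →
                    ∀ v {e} → e ∈ T v → ∃ λ j → β v (cs j) ≡ just e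
          hit-all hit v {e} e∈T with sum>0⇒∃ (λ x → assigned (β v x) e) (≤-trans 1≤s (β-demand v e∈T))
          ... | x , eq with All.lookup hit (∈-filter⁺ (λ F → s ≤? ∣ F ∣)
                  (∈-cartesianProductWith⁺ block (∈-allFin v) (∈-allFin x)) big)
            where
            open ≤-Reasoning
            βx≡e : β v x ≡ just e
            βx≡e = assigned⇒≡ (β v x) eq
            big : s ≤ ∣ block v x ∣
            big = begin
              s                                        ≤⟨ β-demand v e∈T ⟩
              sum (λ y → 𝟙 (assigned (β v y) e))       ≤⟨ sum-mono pointwise ⟩
              sum (λ y → 𝟙 (does (β v y ≟ β v x)))     ≡⟨ ∣toSubset∣ (λ y → β v y ≟ β v x) ⟨
              ∣ block v x ∣                            ∎
              where
              pointwise : ∀ y → 𝟙 (assigned (β v y) e) ≤ 𝟙 (does (β v y ≟ β v x))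
              pointwise y with assigned (β v y) e in eq
              ... | false = z≤n
              ... | true  = ≤-reflexive (cong 𝟙 (sym (dec-true (β v y ≟ β v x)
                              (trans (assigned⇒≡ (β v y) eq) (sym βx≡e)))))
          ... | j , csj∈ = j , trans (∈-toSubset⁻ (λ y → β v y ≟ β v x) csj∈) (assigned⇒≡ (β v x) eq)

          plan : ∀ v x → ∃ λ y → Walk t x y × (∀ {e} → β v x ≡ just e → Guard e y)
          plan v x with β v x in eq
          ... | nothing = x , Walk-refl t , λ ()
          ... | just e with β-reaches v x eq
          ... | y , w , g = y , w , λ { refl → g }

        -- The cops are placed before `v` is known, so one hitting set has to serve the blocks of
        -- all `v`; only the goals given by `plan` depend on the robber's start.
        surround-by : ∃ λ c → n ^ c ≤ n * n * (n ∸ s) ^ c × CopsWin G (suc c)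
        surround-by with greedy-hitting-set 1≤s s≤n blocks (All.all-filter (λ F → s ≤? ∣ F ∣) candidates)
        ... | c , n^c≤ , cs , hit = c
          , ≤-trans n^c≤ (*-monoˡ-≤ ((n ∸ s) ^ c) (⊔-lub (>-nonZero⁻¹ (n * n) {{m*n≢0 n n}}) length-blocks))
          , cs , λ v → march t (λ j → proj₁ (proj₂ (plan v (cs j)))) λ w →
              let (e , e∈T , respond-e) = respond w
                  (j , eq) = hit-all hit v e∈T
              in j , respond-e (proj₂ (proj₂ (plan v (cs j))) eq)

      surround : ∀ {s} → 1 ≤ s → s ≤ n → .{{_ : NonZero n}} →
        (∀ v B S → B ⊆ T v → (∀ x → (x ∈ S ⇔ ∃ λ e → e ∈ B × Reaches e x)) → s * ∣ B ∣ ≤ ∣ S ∣) →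
        (∀ {v r} → Walk t v r → ∃ λ e → e ∈ T v × (∀ {y} → Guard e y → Move G y r)) →
        ∃ λ c → n ^ c ≤ n * n * (n ∸ s) ^ c × CopsWin G (suc c)
      surround 1≤s s≤n expand = surround-by 1≤s s≤n (proj₁ ∘ assignment expand)
        (proj₁ ∘ proj₂ ∘ assignment expand) (λ v → proj₂ (proj₂ (assignment expand v)))

-- Rational arithmetic and Taylor sums of the exponential.

module Exponential where

  open import Data.Nat as ℕ using (ℕ; zero; suc; NonZero)
  import Data.Nat.Properties as ℕ
  import Data.Integer as ℤ
  import Data.Integer.Properties as ℤ
  open import Data.Rational hiding (NonZero)
  open import Data.Rational.Properties
  open import Data.Rational.Solver using (module +-*-Solver)
  open +-*-Solver using (solve; _:=_; _:+_; _:*_; :-_; con)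
  import Data.Rational.Unnormalised as ℚᵘ
  import Data.Rational.Unnormalised.Properties as ℚᵘ
  open import Relation.Nullary using (yes; no; contradiction)
  open import Relation.Binary.PropositionalEquality using (_≡_; refl; sym; trans; cong; cong₂; subst)

  toℚᵘ-ℕ→ℚ : ∀ a → toℚᵘ (ℕ→ℚ a) ℚᵘ.≃ ℚᵘ.mkℚᵘ (ℤ.+ a) 0
  toℚᵘ-ℕ→ℚ a = toℚᵘ-fromℚᵘ (ℚᵘ.mkℚᵘ (ℤ.+ a) 0)

  ℕ→ℚ-+ : ∀ a b → ℕ→ℚ (a ℕ.+ b) ≡ ℕ→ℚ a + ℕ→ℚ b
  ℕ→ℚ-+ a b = toℚᵘ-injective (begin
    toℚᵘ (ℕ→ℚ (a ℕ.+ b))                              ≈⟨ toℚᵘ-ℕ→ℚ (a ℕ.+ b) ⟩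
    ℚᵘ.mkℚᵘ (ℤ.+ (a ℕ.+ b)) 0                         ≈⟨ ℚᵘ.*≡* (cong (ℤ._* ℤ.1ℤ) (sym
                                                          (cong₂ ℤ._+_ (ℤ.*-identityʳ (ℤ.+ a)) (ℤ.*-identityʳ (ℤ.+ b))))) ⟩
    ℚᵘ.mkℚᵘ (ℤ.+ a) 0 ℚᵘ.+ ℚᵘ.mkℚᵘ (ℤ.+ b) 0          ≈⟨ ℚᵘ.+-cong (toℚᵘ-ℕ→ℚ a) (toℚᵘ-ℕ→ℚ b) ⟨
    toℚᵘ (ℕ→ℚ a) ℚᵘ.+ toℚᵘ (ℕ→ℚ b)                    ≈⟨ toℚᵘ-homo-+ (ℕ→ℚ a) (ℕ→ℚ b) ⟨
    toℚᵘ (ℕ→ℚ a + ℕ→ℚ b)                              ∎)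
    where open ℚᵘ.≃-Reasoning

  ℕ→ℚ-* : ∀ a b → ℕ→ℚ (a ℕ.* b) ≡ ℕ→ℚ a * ℕ→ℚ b
  ℕ→ℚ-* a b = toℚᵘ-injective (begin
    toℚᵘ (ℕ→ℚ (a ℕ.* b))                              ≈⟨ toℚᵘ-ℕ→ℚ (a ℕ.* b) ⟩
    ℚᵘ.mkℚᵘ (ℤ.+ (a ℕ.* b)) 0                         ≈⟨ ℚᵘ.*≡* (cong (ℤ._* ℤ.1ℤ) (ℤ.pos-* a b)) ⟩
    ℚᵘ.mkℚᵘ (ℤ.+ a) 0 ℚᵘ.* ℚᵘ.mkℚᵘ (ℤ.+ b) 0          ≈⟨ ℚᵘ.*-cong (toℚᵘ-ℕ→ℚ a) (toℚᵘ-ℕ→ℚ b) ⟨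
    toℚᵘ (ℕ→ℚ a) ℚᵘ.* toℚᵘ (ℕ→ℚ b)                    ≈⟨ toℚᵘ-homo-* (ℕ→ℚ a) (ℕ→ℚ b) ⟨
    toℚᵘ (ℕ→ℚ a * ℕ→ℚ b)                              ∎)
    where open ℚᵘ.≃-Reasoning

  ℕ→ℚ-mono : ∀ {a b} → a ℕ.≤ b → ℕ→ℚ a ≤ ℕ→ℚ b
  ℕ→ℚ-mono {a} {b} a≤b = toℚᵘ-cancel-≤
    (ℚᵘ.≤-respˡ-≃ (ℚᵘ.≃-sym (toℚᵘ-ℕ→ℚ a)) (ℚᵘ.≤-respʳ-≃ (ℚᵘ.≃-sym (toℚᵘ-ℕ→ℚ b))
      (ℚᵘ.*≤* (ℤ.*-monoʳ-≤-nonNeg ℤ.1ℤ (ℤ.+≤+ a≤b)))))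

  ℕ→ℚ-mono-< : ∀ {a b} → a ℕ.< b → ℕ→ℚ a < ℕ→ℚ b
  ℕ→ℚ-mono-< {a} {b} a<b = toℚᵘ-cancel-<
    (ℚᵘ.<-respˡ-≃ (ℚᵘ.≃-sym (toℚᵘ-ℕ→ℚ a)) (ℚᵘ.<-respʳ-≃ (ℚᵘ.≃-sym (toℚᵘ-ℕ→ℚ b))
      (ℚᵘ.*<* (ℤ.*-monoʳ-<-pos ℤ.1ℤ (ℤ.+<+ a<b)))))

  ℕ→ℚ-cancel : ∀ {a b} → ℕ→ℚ a ≤ ℕ→ℚ b → a ℕ.≤ b
  ℕ→ℚ-cancel {a} {b} a≤b with a ℕ.≤? b
  ... | yes p = p
  ... | no  p = contradiction (<-≤-trans (ℕ→ℚ-mono-< {b} {a} (ℕ.≰⇒> p)) a≤b) (<-irrefl refl)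

  ℕ→ℚ-suc : ∀ a → ℕ→ℚ (suc a) ≡ 1ℚ + ℕ→ℚ a
  ℕ→ℚ-suc a = ℕ→ℚ-+ 1 a

  0≤ℕ→ℚ : ∀ a → 0ℚ ≤ ℕ→ℚ a
  0≤ℕ→ℚ a = ℕ→ℚ-mono {0} {a} ℕ.z≤n

  *-monoˡ : ∀ {c a b} → 0ℚ ≤ c → a ≤ b → c * a ≤ c * b
  *-monoˡ {c} 0≤c = *-monoˡ-≤-nonNeg c {{nonNegative 0≤c}}

  *-monoʳ : ∀ {c a b} → 0ℚ ≤ c → a ≤ b → a * c ≤ b * c
  *-monoʳ {c} 0≤c = *-monoʳ-≤-nonNeg c {{nonNegative 0≤c}}

  0≤* : ∀ {a b} → 0ℚ ≤ a → 0ℚ ≤ b → 0ℚ ≤ a * b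
  0≤* {a} {b} 0≤a 0≤b = subst (_≤ a * b) (*-zeroʳ a) (*-monoˡ 0≤a 0≤b)

  *-mono : ∀ {a b c d} → 0ℚ ≤ a → 0ℚ ≤ d → a ≤ b → c ≤ d → a * c ≤ b * d
  *-mono 0≤a 0≤d a≤b c≤d = ≤-trans (*-monoˡ 0≤a c≤d) (*-monoʳ 0≤d a≤b)

  square-mono : ∀ {a b} → 0ℚ ≤ a → a ≤ b → a * a ≤ b * b
  square-mono 0≤a a≤b = *-mono 0≤a (≤-trans 0≤a a≤b) a≤b a≤b

  -- This replaces taking square roots: bounds involving √(nk) or √(n/k) are proved between squares.
  square-cancel : ∀ {a b} → 0ℚ ≤ b → a * a ≤ b * b → a ≤ b
  square-cancel {a} {b} 0≤b aa≤bb with a ≤? b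
  ... | yes a≤b = a≤b
  ... | no  a≰b = contradiction (≤-<-trans (*-monoˡ 0≤b (<⇒≤ b<a))
      (<-≤-trans (*-monoˡ-<-pos a {{positive (≤-<-trans 0≤b b<a)}} b<a) aa≤bb)) (<-irrefl refl)
    where b<a = ≰⇒> a≰b

  *-cancelˡ : ∀ {c a b} → 0ℚ < c → c * a ≤ c * b → a ≤ b
  *-cancelˡ {c} 0<c = *-cancelˡ-≤-pos c {{positive 0<c}}

  0≤^ : ∀ {a} → 0ℚ ≤ a → ∀ r → 0ℚ ≤ a ^ℚ r
  0≤^ 0≤a zero    = 0≤ℕ→ℚ 1
  0≤^ 0≤a (suc r) = 0≤* (0≤^ 0≤a r) 0≤a

  ^-mono : ∀ {a b} → 0ℚ ≤ a → a ≤ b → ∀ r → a ^ℚ r ≤ b ^ℚ r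
  ^-mono 0≤a a≤b zero    = ≤-refl
  ^-mono 0≤a a≤b (suc r) = *-mono (0≤^ 0≤a r) (≤-trans 0≤a a≤b) (^-mono 0≤a a≤b r) a≤b

  ^-distrib-* : ∀ a b r → (a * b) ^ℚ r ≡ a ^ℚ r * b ^ℚ r
  ^-distrib-* a b zero    = refl
  ^-distrib-* a b (suc r) = trans (cong (_* (a * b)) (^-distrib-* a b r))
    (solve 4 (λ a b x y → x :* y :* (a :* b) := x :* a :* (y :* b)) refl a b (a ^ℚ r) (b ^ℚ r))

  ^-+ : ∀ a r t → a ^ℚ (r ℕ.+ t) ≡ a ^ℚ r * a ^ℚ t
  ^-+ a zero    t = sym (*-identityˡ (a ^ℚ t))
  ^-+ a (suc r) t = trans (cong (_* a) (^-+ a r t))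
    (solve 3 (λ a x y → x :* y :* a := x :* a :* y) refl a (a ^ℚ r) (a ^ℚ t))

  ℕ→ℚ-^ : ∀ a r → ℕ→ℚ (a ℕ.^ r) ≡ ℕ→ℚ a ^ℚ r
  ℕ→ℚ-^ a zero    = refl
  ℕ→ℚ-^ a (suc r) = trans (ℕ→ℚ-* a (a ℕ.^ r))
    (trans (*-comm (ℕ→ℚ a) _) (cong (_* ℕ→ℚ a) (ℕ→ℚ-^ a r)))

  /-* : ∀ a n .{{_ : NonZero n}} → ((ℤ.+ a) / n) * ℕ→ℚ n ≡ ℕ→ℚ a
  /-* a n@(suc n′) = toℚᵘ-injective (begin
    toℚᵘ ((ℤ.+ a) / n * ℕ→ℚ n)                        ≈⟨ toℚᵘ-homo-* ((ℤ.+ a) / n) (ℕ→ℚ n) ⟩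
    toℚᵘ ((ℤ.+ a) / n) ℚᵘ.* toℚᵘ (ℕ→ℚ n)              ≈⟨ ℚᵘ.*-cong (toℚᵘ-fromℚᵘ (ℚᵘ.mkℚᵘ (ℤ.+ a) n′)) (toℚᵘ-ℕ→ℚ n) ⟩
    ℚᵘ.mkℚᵘ (ℤ.+ a) n′ ℚᵘ.* ℚᵘ.mkℚᵘ (ℤ.+ n) 0         ≈⟨ ℚᵘ.*≡* (trans (ℤ.*-identityʳ _)
                                                          (cong (λ z → ℤ.+ a ℤ.* (ℤ.+ z)) (sym (ℕ.*-identityʳ n)))) ⟩
    ℚᵘ.mkℚᵘ (ℤ.+ a) 0                                 ≈⟨ toℚᵘ-ℕ→ℚ a ⟨
    toℚᵘ (ℕ→ℚ a)                                      ∎)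
    where open ℚᵘ.≃-Reasoning

  recip : ℕ → ℚ
  recip i = (ℤ.+ 1) / suc i

  recip-inverse : ∀ i → ℕ→ℚ (suc i) * recip i ≡ 1ℚ
  recip-inverse i = trans (*-comm (ℕ→ℚ (suc i)) (recip i)) (/-* 1 (suc i))

  0≤recip : ∀ i → 0ℚ ≤ recip i
  0≤recip i = nonNegative⁻¹ (recip i) {{normalize-nonNeg 1 (suc i)}}

  0≤expTerm : ∀ {q} → 0ℚ ≤ q → ∀ i → 0ℚ ≤ expTerm q i
  0≤expTerm 0≤q zero    = 0≤ℕ→ℚ 1
  0≤expTerm 0≤q (suc i) = 0≤* (0≤* (0≤expTerm 0≤q i) 0≤q) (0≤recip i)

  0≤expPartial : ∀ {q} → 0ℚ ≤ q → ∀ N → 0ℚ ≤ expPartial q N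
  0≤expPartial 0≤q zero    = ≤-refl
  0≤expPartial 0≤q (suc N) = +-mono-≤ (0≤expPartial 0≤q N) (0≤expTerm 0≤q N)

  expTerm-mono : ∀ {p q} → 0ℚ ≤ p → p ≤ q → ∀ i → expTerm p i ≤ expTerm q i
  expTerm-mono 0≤p p≤q zero    = ≤-refl
  expTerm-mono 0≤p p≤q (suc i) = *-monoʳ (0≤recip i)
    (*-mono (0≤expTerm 0≤p i) (≤-trans 0≤p p≤q) (expTerm-mono 0≤p p≤q i) p≤q)

  expTerm-suc : ∀ q i → expTerm q i * q ≡ expTerm q (suc i) * ℕ→ℚ (suc i)
  expTerm-suc q i = sym (trans (*-assoc (expTerm q i * q) (recip i) _)
    (trans (cong (expTerm q i * q *_) (trans (*-comm (recip i) _) (recip-inverse i))) (*-identityʳ _)))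

  module _ {x y : ℚ} (0≤x : 0ℚ ≤ x) (0≤y : 0ℚ ≤ y) where

    private
      0≤x+y : 0ℚ ≤ x + y
      0≤x+y = +-mono-≤ 0≤x 0≤y

      x≤x+y : x ≤ x + y
      x≤x+y = subst (_≤ x + y) (+-identityʳ x) (+-monoʳ-≤ x 0≤y)

    -- The mean value estimate (x + y)ⁱ⁺¹ ≤ xⁱ⁺¹ + (i + 1) y (x + y)ⁱ divided by (i + 1)!.
    expTerm-increment : ∀ i → expTerm (x + y) (suc i) ≤ expTerm x (suc i) + y * expTerm (x + y) i
    expTerm-increment zero = ≤-reflexive
      (solve 2 (λ x y → con 1ℚ :* (x :+ y) :* con 1ℚ := con 1ℚ :* x :* con 1ℚ :+ y :* con 1ℚ) refl x y)
    expTerm-increment (suc i) = begin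
      a₁ * (x + y) * v
        ≤⟨ *-monoʳ (0≤recip (suc i)) (*-monoʳ 0≤x+y (expTerm-increment i)) ⟩
      (b₁ + y * a₀) * (x + y) * v
        ≡⟨ solve 5 (λ x y a b v → (b :+ y :* a) :* (x :+ y) :* v
                               := b :* x :* v :+ y :* v :* (b :+ a :* (x :+ y))) refl x y a₀ b₁ v ⟩
      b₁ * x * v + y * v * (b₁ + a₀ * (x + y))
        ≡⟨ cong (λ z → b₁ * x * v + y * v * (b₁ + z)) (expTerm-suc (x + y) i) ⟩
      b₁ * x * v + y * v * (b₁ + a₁ * ℕ→ℚ (suc i))
        ≤⟨ +-monoʳ-≤ (b₁ * x * v) (*-monoˡ (0≤* 0≤y (0≤recip (suc i)))
             (+-monoˡ-≤ (a₁ * ℕ→ℚ (suc i)) (expTerm-mono 0≤x x≤x+y (suc i)))) ⟩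
      b₁ * x * v + y * v * (a₁ + a₁ * ℕ→ℚ (suc i))
        ≡⟨ solve 5 (λ c y v a j → c :+ y :* v :* (a :+ a :* j) := c :+ y :* a :* ((con 1ℚ :+ j) :* v))
             refl (b₁ * x * v) y v a₁ (ℕ→ℚ (suc i)) ⟩
      b₁ * x * v + y * a₁ * ((1ℚ + ℕ→ℚ (suc i)) * v)
        ≡⟨ cong (λ z → b₁ * x * v + y * a₁ * z)
             (trans (cong (_* v) (sym (ℕ→ℚ-suc (suc i)))) (recip-inverse (suc i))) ⟩
      b₁ * x * v + y * a₁ * 1ℚ
        ≡⟨ cong (b₁ * x * v +_) (*-identityʳ (y * a₁)) ⟩
      b₁ * x * v + y * a₁ ∎
      where
      open ≤-Reasoning
      a₀ = expTerm (x + y) i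
      a₁ = expTerm (x + y) (suc i)
      b₁ = expTerm x (suc i)
      v  = recip (suc i)

    expPartial-increment′ : ∀ N → expPartial (x + y) (suc N) ≤ expPartial x (suc N) + y * expPartial (x + y) N
    expPartial-increment′ zero = ≤-reflexive (sym (trans (cong (1ℚ +_) (*-zeroʳ y)) (+-identityʳ 1ℚ)))
    expPartial-increment′ (suc N) = begin
      expPartial (x + y) (suc N) + expTerm (x + y) (suc N)
        ≤⟨ +-mono-≤ (expPartial-increment′ N) (expTerm-increment N) ⟩
      expPartial x (suc N) + y * expPartial (x + y) N + (expTerm x (suc N) + y * expTerm (x + y) N)
        ≡⟨ solve 5 (λ e y f t u → e :+ y :* f :+ (t :+ y :* u) := e :+ t :+ y :* (f :+ u)) refl
             (expPartial x (suc N)) y (expPartial (x + y) N) (expTerm x (suc N)) (expTerm (x + y) N) ⟩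
      expPartial x (suc (suc N)) + y * expPartial (x + y) (suc N) ∎
      where open ≤-Reasoning

    -- The truncated form of exp(x + y) (1 - y) ≤ exp x: in the preceding estimate the shorter sum
    -- is enlarged by its nonnegative last term and moved to the left.
    expPartial-increment : ∀ N → expPartial (x + y) N * (1ℚ - y) ≤ expPartial x N
    expPartial-increment zero    = ≤-reflexive (*-zeroˡ (1ℚ - y))
    expPartial-increment (suc N) = begin
      e * (1ℚ - y)
        ≡⟨ solve 2 (λ e y → e :* (con 1ℚ :+ (:- y)) := e :+ (:- (y :* e))) refl e y ⟩
      e - y * e
        ≤⟨ +-monoˡ-≤ (- (y * e)) (≤-trans (expPartial-increment′ N)
             (+-monoʳ-≤ (expPartial x (suc N)) (*-monoˡ 0≤y
               (subst (_≤ e) (+-identityʳ e₀) (+-monoʳ-≤ e₀ (0≤expTerm 0≤x+y N)))))) ⟩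
      expPartial x (suc N) + y * e - y * e
        ≡⟨ solve 2 (λ f g → f :+ g :+ (:- g) := f) refl (expPartial x (suc N)) (y * e) ⟩
      expPartial x (suc N) ∎
      where
      open ≤-Reasoning
      e₀ = expPartial (x + y) N
      e  = expPartial (x + y) (suc N)

  expPartial-0≤1 : ∀ N → expPartial 0ℚ N ≤ 1ℚ
  expPartial-0≤1 zero    = 0≤ℕ→ℚ 1
  expPartial-0≤1 (suc N) = ≤-reflexive (go N)
    where
    go : ∀ N → expPartial 0ℚ (suc N) ≡ 1ℚ
    go zero    = refl
    go (suc N) = trans (cong₂ _+_ (go N)
      (trans (cong (_* recip N) (*-zeroʳ (expTerm 0ℚ N))) (*-zeroˡ (recip N)))) (+-identityʳ 1ℚ)

  -- This is exp(My) ≤ (1 - y)⁻ᴹ, obtained from `M` increments by `y` and written as a product to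
  -- avoid division.
  expPartial-geometric : ∀ {y} → 0ℚ ≤ y → y ≤ 1ℚ → ∀ M N →
    expPartial (ℕ→ℚ M * y) N * (1ℚ - y) ^ℚ M ≤ 1ℚ
  expPartial-geometric {y} 0≤y y≤1 zero N = begin
    expPartial (0ℚ * y) N * 1ℚ   ≡⟨ *-identityʳ _ ⟩
    expPartial (0ℚ * y) N        ≡⟨ cong (λ z → expPartial z N) (*-zeroˡ y) ⟩
    expPartial 0ℚ N              ≤⟨ expPartial-0≤1 N ⟩
    1ℚ                           ∎
    where open ≤-Reasoning
  expPartial-geometric {y} 0≤y y≤1 (suc M) N = begin
    expPartial (ℕ→ℚ (suc M) * y) N * (u ^ℚ M * u)
      ≡⟨ cong (λ z → expPartial z N * (u ^ℚ M * u)) (trans (cong (_* y) (ℕ→ℚ-suc M))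
           (solve 2 (λ m y → (con 1ℚ :+ m) :* y := m :* y :+ y) refl (ℕ→ℚ M) y)) ⟩
    expPartial (ℕ→ℚ M * y + y) N * (u ^ℚ M * u)
      ≡⟨ solve 3 (λ e p u → e :* (p :* u) := e :* u :* p) refl (expPartial (ℕ→ℚ M * y + y) N) (u ^ℚ M) u ⟩
    expPartial (ℕ→ℚ M * y + y) N * u * u ^ℚ M
      ≤⟨ *-monoʳ (0≤^ 0≤u M) (expPartial-increment (0≤* (0≤ℕ→ℚ M) 0≤y) 0≤y N) ⟩
    expPartial (ℕ→ℚ M * y) N * u ^ℚ M
      ≤⟨ expPartial-geometric 0≤y y≤1 M N ⟩
    1ℚ ∎
    where
    open ≤-Reasoning
    u = 1ℚ - y
    0≤u : 0ℚ ≤ u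
    0≤u = subst (_≤ u) (+-inverseʳ y) (+-monoˡ-≤ (- y) y≤1)

  0<ℕ→ℚ : ∀ {a} → 1 ℕ.≤ a → 0ℚ < ℕ→ℚ a
  0<ℕ→ℚ {a} = ℕ→ℚ-mono-< {0} {a}

  -- The geometric bound with one increment: exp q ≤ 1/(1 - q), which is at most 2 for q ≤ 1/2.
  expPartial≤2 : ∀ {q} → 0ℚ ≤ q → q + q ≤ 1ℚ → ∀ N → expPartial q N ≤ ℕ→ℚ 2
  expPartial≤2 {q} 0≤q 2q≤1 N = begin
    e                                ≡⟨ *-identityʳ e ⟨
    e * 1ℚ                           ≤⟨ *-monoˡ (0≤expPartial 0≤q N) 1≤2-2q ⟩
    e * (ℕ→ℚ 2 - (q + q))            ≡⟨ solve 2 (λ e q → e :* (con (ℕ→ℚ 2) :+ (:- (q :+ q)))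
                                          := con (ℕ→ℚ 2) :* (e :* (con 1ℚ :* (con 1ℚ :+ (:- q))))) refl e q ⟩
    ℕ→ℚ 2 * (e * (1ℚ - q) ^ℚ 1)      ≡⟨ cong (λ z → ℕ→ℚ 2 * (expPartial z N * (1ℚ - q) ^ℚ 1)) (*-identityˡ q) ⟨
    ℕ→ℚ 2 * (expPartial (ℕ→ℚ 1 * q) N * (1ℚ - q) ^ℚ 1)
                                     ≤⟨ *-monoˡ (0≤ℕ→ℚ 2) (expPartial-geometric 0≤q q≤1 1 N) ⟩
    ℕ→ℚ 2 * 1ℚ                       ≡⟨ *-identityʳ (ℕ→ℚ 2) ⟩
    ℕ→ℚ 2                            ∎
    where
    open ≤-Reasoning
    e = expPartial q N
    q≤1 : q ≤ 1ℚ
    q≤1 = ≤-trans (subst (_≤ q + q) (+-identityʳ q) (+-monoʳ-≤ q 0≤q)) 2q≤1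
    1≤2-2q : 1ℚ ≤ ℕ→ℚ 2 - (q + q)
    1≤2-2q = +-monoʳ-≤ (ℕ→ℚ 2) (neg-antimono-≤ 2q≤1)

  -- The hypothesis amounts to q ≤ 1/10. This settles the two degenerate cases, a single cop and s ≤
  -- 1.
  expPartial≤n-small : ∀ {n q} → 2 ℕ.≤ n → 0ℚ ≤ q → ℕ→ℚ 20 * q * ℕ→ℚ n ≤ ℕ→ℚ n * ℕ→ℚ 2 →
    ∀ N → expPartial q N ≤ ℕ→ℚ n
  expPartial≤n-small {n} {q} 2≤n 0≤q 20qn≤2n N =
    ≤-trans (expPartial≤2 0≤q 2q≤1 N) (ℕ→ℚ-mono {2} {n} 2≤n)
    where
    20q≤2 : ℕ→ℚ 20 * q ≤ ℕ→ℚ 2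
    20q≤2 = *-cancelˡ (0<ℕ→ℚ (ℕ.≤-trans (ℕ.s≤s ℕ.z≤n) 2≤n))
      (subst (_≤ ℕ→ℚ n * ℕ→ℚ 2) (*-comm (ℕ→ℚ 20 * q) (ℕ→ℚ n)) 20qn≤2n)
    2q≤1 : q + q ≤ 1ℚ
    2q≤1 = *-cancelˡ (0<ℕ→ℚ {10} (ℕ.s≤s ℕ.z≤n)) (≤-trans (≤-reflexive
      (solve 1 (λ q → con (ℕ→ℚ 10) :* (q :+ q) := con (ℕ→ℚ 20) :* q) refl q))
      (≤-trans 20q≤2 (ℕ→ℚ-mono {2} {10} (ℕ.s≤s (ℕ.s≤s ℕ.z≤n)))))

  -- With q = M y this is exp q ≤ (1 − y)⁻ᴹ ≤ (1 − s/n)^(−M/2) ≤ n, using (1 − y)² ≥ 1 − 2y ≥ 1 − s/n.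
  expPartial≤n : ∀ {n s} M {q} → 2 ℕ.≤ n → 1 ℕ.≤ s → s ℕ.≤ n →
    n ℕ.^ M ℕ.≤ n ℕ.* n ℕ.* (n ℕ.∸ s) ℕ.^ M → 0ℚ ≤ q →
    ℕ→ℚ 20 * q * ℕ→ℚ n ≤ ℕ→ℚ (suc M) * ℕ→ℚ (suc s) → ∀ N → expPartial q N ≤ ℕ→ℚ n
  -- With one cop, s + 1 ≤ 2n alone makes `q` small.
  expPartial≤n {n} {s} zero {q} 2≤n 1≤s s≤n _ 0≤q 20qn≤ = expPartial≤n-small 2≤n 0≤q (begin
    ℕ→ℚ 20 * q * ℕ→ℚ n           ≤⟨ 20qn≤ ⟩
    ℕ→ℚ 1 * ℕ→ℚ (suc s)          ≡⟨ *-identityˡ _ ⟩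
    ℕ→ℚ (suc s)                  ≤⟨ ℕ→ℚ-mono {suc s} {n ℕ.* 2} (ℕ.≤-trans (ℕ.+-mono-≤ (ℕ.≤-trans 1≤s s≤n) s≤n)
                                      (ℕ.≤-reflexive (trans (cong (n ℕ.+_) (sym (ℕ.+-identityʳ n))) (ℕ.*-comm 2 n)))) ⟩
    ℕ→ℚ (n ℕ.* 2)                ≡⟨ ℕ→ℚ-* n 2 ⟩
    ℕ→ℚ n * ℕ→ℚ 2                ∎)
    where open ≤-Reasoning
  expPartial≤n {n} {s} M@(suc M′) {q} 2≤n 1≤s s≤n n^M≤ 0≤q 20qn≤ N = begin
    e                        ≡⟨ *-identityʳ e ⟨
    e * 1ℚ                   ≤⟨ *-monoˡ (0≤expPartial 0≤q N) 1≤nU ⟩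
    e * (ν * U)              ≡⟨ solve 3 (λ e ν u → e :* (ν :* u) := ν :* (e :* u)) refl e ν U ⟩
    ν * (e * U)              ≡⟨ cong (λ z → ν * (expPartial z N * U)) q≡My ⟩
    ν * (expPartial (ℕ→ℚ M * y) N * U)
                             ≤⟨ *-monoˡ (0≤ℕ→ℚ n) (expPartial-geometric 0≤y y≤1 M N) ⟩
    ν * 1ℚ                   ≡⟨ *-identityʳ ν ⟩
    ν                        ∎
    where
    open ≤-Reasoning
    e = expPartial q N
    ν = ℕ→ℚ n
    σ = ℕ→ℚ s
    y = q * recip M′
    u = 1ℚ - y
    U = u ^ℚ M

    0<ν : 0ℚ < ν
    0<ν = 0<ℕ→ℚ (ℕ.≤-trans (ℕ.s≤s ℕ.z≤n) 2≤n)

    0≤y : 0ℚ ≤ y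
    0≤y = 0≤* 0≤q (0≤recip M′)

    q≡My : q ≡ ℕ→ℚ M * y
    q≡My = sym (trans (solve 3 (λ m q r → m :* (q :* r) := q :* (m :* r)) refl (ℕ→ℚ M) q (recip M′))
      (trans (cong (q *_) (recip-inverse M′)) (*-identityʳ q)))

    -- The factor 4 comes from M + 1 ≤ 2M and s + 1 ≤ 2s, valid because both are at least 1.
    20yn≤4s : ℕ→ℚ 20 * (y * ν) ≤ ℕ→ℚ 4 * σ
    20yn≤4s = *-cancelˡ (0<ℕ→ℚ {M} (ℕ.s≤s ℕ.z≤n)) (begin
      ℕ→ℚ M * (ℕ→ℚ 20 * (y * ν))
        ≡⟨ solve 4 (λ m c y v → m :* (c :* (y :* v)) := c :* (m :* y) :* v) refl (ℕ→ℚ M) (ℕ→ℚ 20) y ν ⟩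
      ℕ→ℚ 20 * (ℕ→ℚ M * y) * ν
        ≡⟨ cong (λ z → ℕ→ℚ 20 * z * ν) q≡My ⟨
      ℕ→ℚ 20 * q * ν
        ≤⟨ 20qn≤ ⟩
      ℕ→ℚ (suc M) * ℕ→ℚ (suc s)
        ≤⟨ *-mono (0≤ℕ→ℚ (suc M)) (0≤ℕ→ℚ (s ℕ.+ s)) (ℕ→ℚ-mono {suc M} {M ℕ.+ M} (ℕ.+-monoˡ-≤ M (ℕ.s≤s (ℕ.z≤n {M′}))))
             (ℕ→ℚ-mono {suc s} {s ℕ.+ s} (ℕ.+-monoˡ-≤ s 1≤s)) ⟩
      ℕ→ℚ (M ℕ.+ M) * ℕ→ℚ (s ℕ.+ s)
        ≡⟨ cong₂ _*_ (ℕ→ℚ-+ M M) (ℕ→ℚ-+ s s) ⟩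
      (ℕ→ℚ M + ℕ→ℚ M) * (σ + σ)
        ≡⟨ solve 2 (λ m s → (m :+ m) :* (s :+ s) := m :* (con (ℕ→ℚ 4) :* s)) refl (ℕ→ℚ M) σ ⟩
      ℕ→ℚ M * (ℕ→ℚ 4 * σ) ∎)

    2yn≤s : (y + y) * ν ≤ σ
    2yn≤s = *-cancelˡ (0<ℕ→ℚ {4} (ℕ.s≤s ℕ.z≤n)) (begin
      ℕ→ℚ 4 * ((y + y) * ν)
        ≡⟨ solve 2 (λ y v → con (ℕ→ℚ 4) :* ((y :+ y) :* v) := con (ℕ→ℚ 8) :* (y :* v)) refl y ν ⟩
      ℕ→ℚ 8 * (y * ν)
        ≤⟨ *-monoʳ (0≤* 0≤y (0≤ℕ→ℚ n)) (ℕ→ℚ-mono {8} {20} (ℕ.m≤m+n 8 12)) ⟩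
      ℕ→ℚ 20 * (y * ν)
        ≤⟨ 20yn≤4s ⟩
      ℕ→ℚ 4 * σ ∎)

    2y≤1 : y + y ≤ 1ℚ
    2y≤1 = *-cancelˡ 0<ν (begin
      ν * (y + y)    ≡⟨ *-comm ν (y + y) ⟩
      (y + y) * ν    ≤⟨ 2yn≤s ⟩
      σ              ≤⟨ ℕ→ℚ-mono {s} {n} s≤n ⟩
      ν              ≡⟨ *-identityʳ ν ⟨
      ν * 1ℚ         ∎)

    y≤1 : y ≤ 1ℚ
    y≤1 = ≤-trans (subst (_≤ y + y) (+-identityʳ y) (+-monoʳ-≤ y 0≤y)) 2y≤1

    0≤u : 0ℚ ≤ u
    0≤u = subst (_≤ u) (+-inverseʳ y) (+-monoˡ-≤ (- y) y≤1)

    n-s≤nu² : ℕ→ℚ (n ℕ.∸ s) ≤ ν * (u * u)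
    n-s≤nu² = begin
      ℕ→ℚ (n ℕ.∸ s)
        ≡⟨ solve 2 (λ a b → a := a :+ b :+ (:- b)) refl (ℕ→ℚ (n ℕ.∸ s)) σ ⟩
      ℕ→ℚ (n ℕ.∸ s) + σ - σ
        ≡⟨ cong (_- σ) (trans (sym (ℕ→ℚ-+ (n ℕ.∸ s) s)) (cong ℕ→ℚ (ℕ.m∸n+n≡m s≤n))) ⟩
      ν - σ
        ≤⟨ +-monoʳ-≤ ν (neg-antimono-≤ 2yn≤s) ⟩
      ν - (y + y) * ν
        ≡⟨ +-identityʳ _ ⟨
      ν - (y + y) * ν + 0ℚ
        ≤⟨ +-monoʳ-≤ (ν - (y + y) * ν) (0≤* (0≤ℕ→ℚ n) (0≤* 0≤y 0≤y)) ⟩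
      ν - (y + y) * ν + ν * (y * y)
        ≡⟨ solve 2 (λ v y → v :+ (:- ((y :+ y) :* v)) :+ v :* (y :* y)
                         := v :* ((con 1ℚ :+ (:- y)) :* (con 1ℚ :+ (:- y)))) refl ν y ⟩
      ν * (u * u) ∎

    1≤nU : 1ℚ ≤ ν * U
    -- The number n² of blocks is matched with U² = u^(2M): the greedy inequality becomes (nU)² ≥ 1
    -- after cancelling n^M.
    1≤nU = square-cancel (0≤* (0≤ℕ→ℚ n) (0≤^ 0≤u M)) (*-cancelˡ 0<ν^M (begin
      ν ^ℚ M * (1ℚ * 1ℚ)
        ≡⟨ *-identityʳ (ν ^ℚ M) ⟩
      ν ^ℚ M
        ≡⟨ ℕ→ℚ-^ n M ⟨
      ℕ→ℚ (n ℕ.^ M)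
        ≤⟨ ℕ→ℚ-mono {n ℕ.^ M} {n ℕ.* n ℕ.* (n ℕ.∸ s) ℕ.^ M} n^M≤ ⟩
      ℕ→ℚ (n ℕ.* n ℕ.* (n ℕ.∸ s) ℕ.^ M)
        ≡⟨ trans (ℕ→ℚ-* (n ℕ.* n) ((n ℕ.∸ s) ℕ.^ M)) (cong₂ _*_ (ℕ→ℚ-* n n) (ℕ→ℚ-^ (n ℕ.∸ s) M)) ⟩
      ν * ν * ℕ→ℚ (n ℕ.∸ s) ^ℚ M
        ≤⟨ *-monoˡ (0≤* (0≤ℕ→ℚ n) (0≤ℕ→ℚ n)) (^-mono (0≤ℕ→ℚ (n ℕ.∸ s)) n-s≤nu² M) ⟩
      ν * ν * (ν * (u * u)) ^ℚ M
        ≡⟨ cong (ν * ν *_) (trans (^-distrib-* ν (u * u) M) (cong (ν ^ℚ M *_) (^-distrib-* u u M))) ⟩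
      ν * ν * (ν ^ℚ M * (U * U))
        ≡⟨ solve 3 (λ v p u → v :* v :* (p :* (u :* u)) := p :* (v :* u :* (v :* u))) refl ν (ν ^ℚ M) U ⟩
      ν ^ℚ M * (ν * U * (ν * U)) ∎))
      where
      0<ν^M : 0ℚ < ν ^ℚ M
      0<ν^M = subst (0ℚ <_) (ℕ→ℚ-^ n M) (0<ℕ→ℚ (ℕ.>-nonZero⁻¹ (n ℕ.^ M)
        {{ℕ.m^n≢0 n M {{ℕ.>-nonZero (ℕ.≤-trans (ℕ.s≤s ℕ.z≤n) 2≤n)}}}}))

  -- The hypothesis of BoundHolds says 20 q ≤ c ξ² √(k/n), and s + 1 bounds ξ² √(nk).
  20qn≤c[s+1] : ∀ {c n k s ξ q} →
    ξ * ξ * (ξ * ξ) * (ℕ→ℚ n * ℕ→ℚ k) ≤ ℕ→ℚ (suc s) * ℕ→ℚ (suc s) →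
    q * q * ℕ→ℚ n * ℕ→ℚ 400 ≤ (ℕ→ℚ c * ξ * ξ) ^ℚ 2 * ℕ→ℚ k →
    ℕ→ℚ 20 * q * ℕ→ℚ n ≤ ℕ→ℚ c * ℕ→ℚ (suc s)
  20qn≤c[s+1] {c} {n} {k} {s} {ξ} {q} ξ⁴nk≤ qq≤ =
    square-cancel (0≤* (0≤ℕ→ℚ c) (0≤ℕ→ℚ (suc s))) (begin
      ℕ→ℚ 20 * q * ν * (ℕ→ℚ 20 * q * ν)
        ≡⟨ solve 2 (λ q v → con (ℕ→ℚ 20) :* q :* v :* (con (ℕ→ℚ 20) :* q :* v)
                         := v :* (q :* q :* v :* con (ℕ→ℚ 400))) refl q ν ⟩
      ν * (q * q * ν * ℕ→ℚ 400)
        ≤⟨ *-monoˡ (0≤ℕ→ℚ n) qq≤ ⟩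
      ν * ((γ * ξ * ξ) ^ℚ 2 * κ)
        ≡⟨ solve 4 (λ v g x k → v :* (con 1ℚ :* (g :* x :* x) :* (g :* x :* x) :* k)
                             := g :* g :* (x :* x :* (x :* x) :* (v :* k))) refl ν γ ξ κ ⟩
      γ * γ * (ξ * ξ * (ξ * ξ) * (ν * κ))
        ≤⟨ *-monoˡ (0≤* (0≤ℕ→ℚ c) (0≤ℕ→ℚ c)) ξ⁴nk≤ ⟩
      γ * γ * (ℕ→ℚ (suc s) * ℕ→ℚ (suc s))
        ≡⟨ solve 2 (λ g t → g :* g :* (t :* t) := g :* t :* (g :* t)) refl γ (ℕ→ℚ (suc s)) ⟩
      γ * ℕ→ℚ (suc s) * (γ * ℕ→ℚ (suc s)) ∎)
    where
    open ≤-Reasoning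
    ν = ℕ→ℚ n
    κ = ℕ→ℚ k
    γ = ℕ→ℚ c

-- Expansion supplies the blocks: choice of s and r, vertex guards and edge guards.

module Surrounding where

  open Combinatorics
  open Pursuit
  open Exponential
  open import Data.Nat as ℕ using (ℕ; zero; suc; NonZero; z≤n; s≤s)
  import Data.Nat.Properties as ℕ
  open import Data.Rational hiding (NonZero; ∣_∣)
  open import Data.Rational.Properties
  open import Data.Rational.Solver using (module +-*-Solver)
  open +-*-Solver using (solve; _:=_; _:*_; con)
  open import Data.Fin using (Fin; zero; suc)
  import Data.Fin.Properties as Fin
  open import Data.Fin.Subset using (Subset; _∈_; _∉_; ∣_∣; ⁅_⁆)
  open import Data.Fin.Subset.Properties using (_∈?_; x∈⁅x⁆; x∈⁅y⁆⇒x≡y; ∣⁅x⁆∣≡1; ∣p∣≤n; p⊆q⇒∣p∣≤∣q∣)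
  open import Data.Product using (∃; _×_; _,_; proj₁; proj₂)
  open import Data.Sum using (inj₁; inj₂; [_,_]′)
  open import Function using (_∘_; id)
  open import Function.Bundles using (_⇔_; mk⇔; Equivalence)
  open import Relation.Nullary using (¬_; yes; no; contradiction)
  open import Relation.Nullary.Decidable using (_×-dec_; decidable-stable)
  open import Relation.Unary using (Decidable)
  open import Relation.Binary.PropositionalEquality using (_≡_; refl; sym; trans; cong; subst; subst₂)

  -- Produces the integer part `s` and the radius `r` as cut-offs of decidable rational
  -- inequalities.
  last-true : ∀ {p} {P : ℕ → Set p} → Decidable P → P 0 → ∀ b → ¬ P b → ∃ λ r → P r × ¬ P (suc r)
  last-true P? P0 zero    ¬P0 = contradiction P0 ¬P0
  last-true P? P0 (suc b) ¬Pb with P? b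
  ... | yes Pb  = b , Pb , ¬Pb
  ... | no  ¬Pb′ = last-true P? P0 b ¬Pb′

  module _ {k n : ℕ} (G : KGraph k n) where

    sumℕ≤ : ∀ {a} (f : Fin a → ℕ) b → (∀ i → f i ℕ.≤ b) → sumℕ G f ℕ.≤ a ℕ.* b
    sumℕ≤ {zero}  f b f≤b = z≤n
    sumℕ≤ {suc a} f b f≤b = ℕ.+-mono-≤ (f≤b zero) (sumℕ≤ (f ∘ suc) b (f≤b ∘ suc))

    -- Together with k ≤ d this yields k ≤ n, on which both s ≤ n and the exclusion of r = 0 for
    -- edge guards rest.
    avgDeg≤n : .{{_ : NonZero n}} → ∀ N1 → avgDeg G N1 ≤ ℕ→ℚ n
    avgDeg≤n N1 = *-cancelˡ (0<ℕ→ℚ (ℕ.>-nonZero⁻¹ n)) (begin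
      ℕ→ℚ n * avgDeg G N1              ≡⟨ *-comm (ℕ→ℚ n) (avgDeg G N1) ⟩
      avgDeg G N1 * ℕ→ℚ n              ≡⟨ /-* (sumℕ G (λ v → ∣ N1 v ∣)) n ⟩
      ℕ→ℚ (sumℕ G (λ v → ∣ N1 v ∣))    ≤⟨ ℕ→ℚ-mono {sumℕ G (λ v → ∣ N1 v ∣)} {n ℕ.* n} (sumℕ≤ (λ v → ∣ N1 v ∣) n (∣p∣≤n ∘ N1)) ⟩
      ℕ→ℚ (n ℕ.* n)                    ≡⟨ ℕ→ℚ-* n n ⟩
      ℕ→ℚ n * ℕ→ℚ n                    ∎)
      where open ≤-Reasoning

  -- Here `D` is the growth per target. In real terms s ≤ ξ²√(nk), √(nk) ≤ D and ξt ≤ √(n/k). So sb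
  -- ≤ ξbD because ξ ≤ 1, and sb ≤ ξ√(nk) · ξt ≤ ξn: each side of the minimum is met.
  expansion⇒hall : ∀ {s b t k n σ ξ D} → 0ℚ ≤ ξ → ξ ≤ 1ℚ → 0ℚ ≤ D → b ℕ.≤ t →
    ℕ→ℚ s * ℕ→ℚ s ≤ ξ * ξ * (ξ * ξ) * (ℕ→ℚ n * ℕ→ℚ k) →
    ξ * ℕ→ℚ t * (ξ * ℕ→ℚ t) * ℕ→ℚ k ≤ ℕ→ℚ n →
    ℕ→ℚ n * ℕ→ℚ k ≤ D * D →
    ξ * (ℕ→ℚ b * D ⊓ ℕ→ℚ n) ≤ ℕ→ℚ σ →
    s ℕ.* b ℕ.≤ σ
  expansion⇒hall {s} {b} {t} {k} {n} {σ} {ξ} {D} 0≤ξ ξ≤1 0≤D b≤t ss≤ tt≤ nk≤ ξmin≤ =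
    ℕ→ℚ-cancel {s ℕ.* b} {σ} (≤-trans (≤-reflexive (ℕ→ℚ-* s b)) (≤-trans sb≤ ξmin≤))
    where
    open ≤-Reasoning
    β = ℕ→ℚ b
    ν = ℕ→ℚ n
    κ = ℕ→ℚ k
    0≤ξξ : 0ℚ ≤ ξ * ξ
    0≤ξξ = 0≤* 0≤ξ 0≤ξ
    sb² : ℕ→ℚ s * β * (ℕ→ℚ s * β) ≤ β * β * (ξ * ξ * (ξ * ξ) * (ν * κ))
    sb² = ≤-trans
      (≤-reflexive (solve 2 (λ s b → s :* b :* (s :* b) := b :* b :* (s :* s)) refl (ℕ→ℚ s) β))
      (*-monoˡ (0≤* (0≤ℕ→ℚ b) (0≤ℕ→ℚ b)) ss≤)
    ξb≤ξt : ξ * β ≤ ξ * ℕ→ℚ t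
    ξb≤ξt = *-monoˡ 0≤ξ (ℕ→ℚ-mono {b} {t} b≤t)
    0≤bbξξ : 0ℚ ≤ β * β * (ξ * ξ)
    0≤bbξξ = 0≤* (0≤* (0≤ℕ→ℚ b) (0≤ℕ→ℚ b)) 0≤ξξ
    sb≤ξbD : ℕ→ℚ s * β ≤ ξ * (β * D)
    sb≤ξbD = square-cancel (0≤* 0≤ξ (0≤* (0≤ℕ→ℚ b) 0≤D)) (begin
      ℕ→ℚ s * β * (ℕ→ℚ s * β)
        ≤⟨ sb² ⟩
      β * β * (ξ * ξ * (ξ * ξ) * (ν * κ))
        ≡⟨ solve 3 (λ b x w → b :* b :* (x :* x :* (x :* x) :* w)
                           := x :* x :* (b :* b :* (x :* x) :* w)) refl β ξ (ν * κ) ⟩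
      ξ * ξ * (β * β * (ξ * ξ) * (ν * κ))
        ≤⟨ *-mono 0≤ξξ (0≤* 0≤bbξξ (0≤* 0≤D 0≤D)) (square-mono 0≤ξ ξ≤1) (*-monoˡ 0≤bbξξ nk≤) ⟩
      1ℚ * 1ℚ * (β * β * (ξ * ξ) * (D * D))
        ≡⟨ solve 3 (λ b x d → con 1ℚ :* con 1ℚ :* (b :* b :* (x :* x) :* (d :* d))
                           := x :* (b :* d) :* (x :* (b :* d))) refl β ξ D ⟩
      ξ * (β * D) * (ξ * (β * D)) ∎)
    sb≤ξn : ℕ→ℚ s * β ≤ ξ * ν
    sb≤ξn = square-cancel (0≤* 0≤ξ (0≤ℕ→ℚ n)) (begin
      ℕ→ℚ s * β * (ℕ→ℚ s * β)
        ≤⟨ sb² ⟩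
      β * β * (ξ * ξ * (ξ * ξ) * (ν * κ))
        ≡⟨ solve 4 (λ b x v k → b :* b :* (x :* x :* (x :* x) :* (v :* k))
                             := x :* x :* v :* (x :* b :* (x :* b) :* k)) refl β ξ ν κ ⟩
      ξ * ξ * ν * (ξ * β * (ξ * β) * κ)
        ≤⟨ *-monoˡ (0≤* 0≤ξξ (0≤ℕ→ℚ n))
             (≤-trans (*-monoʳ (0≤ℕ→ℚ k) (square-mono (0≤* 0≤ξ (0≤ℕ→ℚ b)) ξb≤ξt)) tt≤) ⟩
      ξ * ξ * ν * ν
        ≡⟨ solve 2 (λ x v → x :* x :* v :* v := x :* v :* (x :* v)) refl ξ ν ⟩
      ξ * ν * (ξ * ν) ∎)
    sb≤ : ℕ→ℚ s * β ≤ ξ * (β * D ⊓ ν)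
    sb≤ = subst (ℕ→ℚ s * β ≤_) (sym (*-distribˡ-⊓-nonNeg ξ {{nonNegative 0≤ξ}} (β * D) ν))
            (⊓-glb sb≤ξbD sb≤ξn)

  module _ {k n : ℕ} (2≤k : 2 ℕ.≤ k) (k≤n : k ℕ.≤ n) .{{_ : NonZero n}} (G : KGraph k n) (ξ d : ℚ)
           (expanding : Expanding G ξ d) where

    private
      k≤d = proj₁ expanding
      0≤ξ = <⇒≤ (proj₁ (proj₂ expanding))
      ξ≤1 = proj₁ (proj₂ (proj₂ expanding))
      A1  = proj₁ (proj₂ (proj₂ (proj₂ expanding)))
      A2  = proj₁ (proj₂ (proj₂ (proj₂ (proj₂ expanding))))
      A3  = proj₂ (proj₂ (proj₂ (proj₂ (proj₂ expanding))))

      ν κ ξ⁴nk : ℚ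
      ν = ℕ→ℚ n
      κ = ℕ→ℚ k
      ξ⁴nk = ξ * ξ * (ξ * ξ) * (ν * κ)

      2≤n : 2 ℕ.≤ n
      2≤n = ℕ.≤-trans 2≤k k≤n

      0≤d : 0ℚ ≤ d
      0≤d = ≤-trans (0≤ℕ→ℚ k) k≤d

      0<κ : 0ℚ < κ
      0<κ = 0<ℕ→ℚ (ℕ.≤-trans (s≤s z≤n) 2≤k)

      -- As d ≥ 2, this crude growth already gives d^(2b) > b for b = nk, so the search for the
      -- radius ends.
      1+r≤d^r : ∀ r → ℕ→ℚ (suc r) ≤ d ^ℚ r
      1+r≤d^r zero    = ≤-refl
      1+r≤d^r (suc r) = begin
        ℕ→ℚ (suc (suc r))       ≤⟨ ℕ→ℚ-mono {suc (suc r)} {suc r ℕ.* 2} (s≤s (s≤s (ℕ.m≤m*n r 2))) ⟩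
        ℕ→ℚ (suc r ℕ.* 2)       ≡⟨ ℕ→ℚ-* (suc r) 2 ⟩
        ℕ→ℚ (suc r) * ℕ→ℚ 2     ≤⟨ *-mono (0≤ℕ→ℚ (suc r)) 0≤d (1+r≤d^r r) (≤-trans (ℕ→ℚ-mono {2} {k} 2≤k) k≤d) ⟩
        d ^ℚ r * d              ∎
        where open ≤-Reasoning

      radius : ∃ λ r → d ^ℚ (r ℕ.+ r) ≤ ℕ→ℚ (n ℕ.* k) × ¬ (d ^ℚ (suc r ℕ.+ suc r) ≤ ℕ→ℚ (n ℕ.* k))
      radius = last-true (λ r → d ^ℚ (r ℕ.+ r) ≤? ℕ→ℚ (n ℕ.* k)) 1≤nk b
        λ le → ℕ.<⇒≱ (ℕ.m≤m+n (suc b) b) (ℕ→ℚ-cancel {suc (b ℕ.+ b)} {b} (≤-trans (1+r≤d^r (b ℕ.+ b)) le))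
        where
        b = n ℕ.* k
        1≤nk : ℕ→ℚ 1 ≤ ℕ→ℚ b
        1≤nk = ℕ→ℚ-mono {1} {b} (ℕ.*-mono-≤ (ℕ.≤-trans (s≤s z≤n) 2≤n) (ℕ.≤-trans (s≤s z≤n) 2≤k))

      ξ⁴nk≤n² : ξ⁴nk ≤ ν * ν
      ξ⁴nk≤n² = begin
        ξ * ξ * (ξ * ξ) * (ν * κ)
          ≤⟨ *-mono (0≤* 0≤ξξ 0≤ξξ) (0≤* (0≤ℕ→ℚ n) (0≤ℕ→ℚ n))
               (square-mono 0≤ξξ (square-mono 0≤ξ ξ≤1)) (*-monoˡ (0≤ℕ→ℚ n) (ℕ→ℚ-mono {k} {n} k≤n)) ⟩
        1ℚ * (ν * ν) ≡⟨ *-identityˡ (ν * ν) ⟩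
        ν * ν ∎
        where
        open ≤-Reasoning
        0≤ξξ = 0≤* 0≤ξ 0≤ξ

      ≤√ξ⁴nk⇒≤n : ∀ s → ℕ→ℚ s * ℕ→ℚ s ≤ ξ⁴nk → s ℕ.≤ n
      ≤√ξ⁴nk⇒≤n s ss≤ = ℕ→ℚ-cancel {s} {n} (square-cancel (0≤ℕ→ℚ n) (≤-trans ss≤ ξ⁴nk≤n²))

      blockSize : ∃ λ s → ℕ→ℚ s * ℕ→ℚ s ≤ ξ⁴nk × ¬ (ℕ→ℚ (suc s) * ℕ→ℚ (suc s) ≤ ξ⁴nk)
      blockSize = last-true (λ s → ℕ→ℚ s * ℕ→ℚ s ≤? ξ⁴nk)
        (0≤* (0≤* 0≤ξξ 0≤ξξ) (0≤* (0≤ℕ→ℚ n) (0≤ℕ→ℚ k))) (suc n)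
        λ le → ℕ.<⇒≱ (ℕ.n<1+n n) (≤√ξ⁴nk⇒≤n (suc n) le)
        where 0≤ξξ = 0≤* 0≤ξ 0≤ξ

    module _ {s : ℕ} (2≤s : 2 ℕ.≤ s) (ss≤ : ℕ→ℚ s * ℕ→ℚ s ≤ ξ⁴nk)
             (r : ℕ) (d²ʳ≤ : d ^ℚ (r ℕ.+ r) ≤ ℕ→ℚ (n ℕ.* k))
             (d²ʳ⁺²≰ : ¬ (d ^ℚ (suc r ℕ.+ suc r) ≤ ℕ→ℚ (n ℕ.* k))) where

      private
        1≤s : 1 ℕ.≤ s
        1≤s = ℕ.≤-trans (s≤s z≤n) 2≤s

        s≤n : s ℕ.≤ n
        s≤n = ≤√ξ⁴nk⇒≤n s ss≤

        nk≤d²ʳ⁺² : ℕ→ℚ (n ℕ.* k) ≤ d ^ℚ (suc r ℕ.+ suc r)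
        nk≤d²ʳ⁺² = <⇒≤ (≰⇒> d²ʳ⁺²≰)

      -- An isolated vertex forces ξ n ≤ 1, hence s² ≤ ξ⁴ n k ≤ 1.
      not-isolated : ∀ u → ¬ (∀ i → u ∉ edge G i)
      not-isolated u isolated = ℕ.<⇒≱ (ℕ.*-mono-≤ 2≤s 1≤s) (ℕ→ℚ-cancel {s ℕ.* s} {1} (begin
        ℕ→ℚ (s ℕ.* s)                      ≡⟨ ℕ→ℚ-* s s ⟩
        ℕ→ℚ s * ℕ→ℚ s                      ≤⟨ ss≤ ⟩
        ξ * ξ * (ξ * ξ) * (ν * κ)          ≡⟨ solve 3 (λ x v k → x :* x :* (x :* x) :* (v :* k)
                                                := x :* x :* (x :* v :* (x :* k))) refl ξ ν κ ⟩
        ξ * ξ * (ξ * ν * (ξ * κ))          ≤⟨ *-mono (0≤* 0≤ξ 0≤ξ) (0≤ℕ→ℚ 1) (square-mono 0≤ξ ξ≤1)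
                                                (*-mono (0≤* 0≤ξ (0≤ℕ→ℚ n)) (0≤ℕ→ℚ 1) ξn≤1 ξk≤1) ⟩
        1ℚ                                 ∎))
        where
        open ≤-Reasoning
        -- An exponent with d^R ≥ n turns the minimum in (A.2) into n; the choice of `r` supplies
        -- this one.
        R = suc r ℕ.+ suc r
        no-chain : ∀ t {v} → ¬ Chain G t u v
        no-chain zero    (i , u∈i , _) = isolated i u∈i
        no-chain (suc t) (i , u∈i , _) = isolated i u∈i
        alone : IsNV G R ⁅ u ⁆ ⁅ u ⁆
        alone v = mk⇔ (λ v∈ → v , v∈ , inj₁ refl) from
          where
          from : DistSetLe G ⁅ u ⁆ v R → v ∈ ⁅ u ⁆
          from (u′ , u′∈ , near) with x∈⁅y⁆⇒x≡y u u′∈ | near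
          ... | refl | inj₁ refl        = x∈⁅x⁆ u
          ... | refl | inj₂ (t , _ , c) = contradiction c (no-chain t)
        n≤d^R : ν ≤ ℕ→ℚ ∣ ⁅ u ⁆ ∣ * d ^ℚ R
        n≤d^R = begin
          ν                        ≤⟨ ℕ→ℚ-mono {n} {n ℕ.* k} (ℕ.m≤m*n n k {{ℕ.>-nonZero (ℕ.≤-trans (s≤s z≤n) 2≤k)}}) ⟩
          ℕ→ℚ (n ℕ.* k)            ≤⟨ nk≤d²ʳ⁺² ⟩
          d ^ℚ R                   ≡⟨ *-identityˡ (d ^ℚ R) ⟨
          ℕ→ℚ 1 * d ^ℚ R           ≡⟨ cong (λ z → ℕ→ℚ z * d ^ℚ R) (∣⁅x⁆∣≡1 u) ⟨
          ℕ→ℚ ∣ ⁅ u ⁆ ∣ * d ^ℚ R   ∎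
        ξn≤1 : ξ * ν ≤ 1ℚ
        ξn≤1 = subst₂ _≤_ (cong (ξ *_) (p≥q⇒p⊓q≡q n≤d^R)) (cong ℕ→ℚ (∣⁅x⁆∣≡1 u))
          (proj₁ (A2 ⁅ u ⁆ R ⁅ u ⁆ (s≤s z≤n) alone))
        ξk≤1 : ξ * κ ≤ 1ℚ
        ξk≤1 = ≤-trans (*-monoˡ 0≤ξ (ℕ→ℚ-mono {k} {n} k≤n)) ξn≤1

      in-some-edge : ∀ u → ∃ λ i → u ∈ edge G i
      in-some-edge u = decidable-stable (Fin.any? (λ i → u ∈? edge G i))
        λ none → not-isolated u λ i u∈i → none (i , u∈i)

      -- A cop guards a vertex from any position one move away, so `r` moves suffice from distance r
      -- + 1. The growth d^(r+1) per target is at least √(nk) by the choice of `r`, and the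
      -- assumption keeps the number of targets at most √(n/k)/ξ.
      guard-vertices : d ^ℚ (r ℕ.+ r) * κ ≤ ν →
        ∃ λ c → n ℕ.^ c ℕ.≤ n ℕ.* n ℕ.* (n ℕ.∸ s) ℕ.^ c × CopsWin G (suc c)
      guard-vertices d²ʳk≤n = surround G r T (λ u y → Move? G y u) 1≤s s≤n
        (λ v B S B⊆T isS → expansion⇒hall {s} {∣ B ∣} {∣ T v ∣} {k} {n} {∣ S ∣} {ξ} {d ^ℚ suc r}
          0≤ξ ξ≤1 (0≤^ 0≤d (suc r)) (p⊆q⇒∣p∣≤∣q∣ B⊆T) ss≤ (T-small v)
          (subst₂ _≤_ (ℕ→ℚ-* n k) (^-+ d (suc r) (suc r)) nk≤d²ʳ⁺²)
          (proj₁ (A2 B (suc r) S (s≤s z≤n) (isNV B S isS))))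
        (λ {v} {u} w → u , ∈-toSubset⁺ (Walk? G r v) w , id)
        where
        open ≤-Reasoning
        T : Fin n → Subset n
        T v = toSubset (Walk? G r v)
        isNV : ∀ B S → (∀ x → (x ∈ S ⇔ ∃ λ u → u ∈ B × ∃ λ y → Walk G r x y × Move G y u)) →
               IsNV G (suc r) B S
        isNV B S isS x = mk⇔
          (λ x∈S → let (u , u∈B , y , w , m) = Equivalence.to (isS x) x∈S in
             u , u∈B , Walk⇒DistLe G (suc r) (Walk-sym G (suc r) (snoc G r w m)))
          (λ (u , u∈B , near) → Equivalence.from (isS x)
             (u , u∈B , unsnoc G r (Walk-sym G (suc r) (DistLe⇒Walk G near))))
        ξT≤ : ∀ v → ∀ r′ → r′ ≡ r → ξ * ℕ→ℚ ∣ T v ∣ ≤ d ^ℚ r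
        -- (A.2) speaks only of positive radii; at radius 0 the set of targets is just {v}.
        ξT≤ v zero    refl = *-mono 0≤ξ (0≤ℕ→ℚ 1) ξ≤1 (ℕ→ℚ-mono {∣ T v ∣} {1} (subst (∣ T v ∣ ℕ.≤_) (∣⁅x⁆∣≡1 v)
          (p⊆q⇒∣p∣≤∣q∣ λ {x} x∈T → subst (_∈ ⁅ v ⁆) (∈-toSubset⁻ (Walk? G 0 v) x∈T) (x∈⁅x⁆ v))))
        ξT≤ v (suc r′) refl = begin
          ξ * ℕ→ℚ ∣ T v ∣            ≤⟨ proj₂ (A2 ⁅ v ⁆ r (T v) (s≤s z≤n) isT) ⟩
          ℕ→ℚ ∣ ⁅ v ⁆ ∣ * d ^ℚ r     ≡⟨ cong (λ z → ℕ→ℚ z * d ^ℚ r) (∣⁅x⁆∣≡1 v) ⟩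
          ℕ→ℚ 1 * d ^ℚ r             ≡⟨ *-identityˡ (d ^ℚ r) ⟩
          d ^ℚ r                     ∎
          where
          isT : IsNV G r ⁅ v ⁆ (T v)
          isT x = mk⇔
            (λ x∈T → v , x∈⁅x⁆ v , Walk⇒DistLe G r (∈-toSubset⁻ (Walk? G r v) x∈T))
            (λ (v′ , v′∈ , near) → ∈-toSubset⁺ (Walk? G r v)
               (subst (λ z → Walk G r z x) (x∈⁅y⁆⇒x≡y v v′∈) (DistLe⇒Walk G near)))
        T-small : ∀ v → ξ * ℕ→ℚ ∣ T v ∣ * (ξ * ℕ→ℚ ∣ T v ∣) * κ ≤ ν
        T-small v = begin
          ξ * ℕ→ℚ ∣ T v ∣ * (ξ * ℕ→ℚ ∣ T v ∣) * κ
            ≤⟨ *-monoʳ (0≤ℕ→ℚ k) (square-mono (0≤* 0≤ξ (0≤ℕ→ℚ ∣ T v ∣)) (ξT≤ v r refl)) ⟩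
          d ^ℚ r * d ^ℚ r * κ
            ≡⟨ cong (_* κ) (^-+ d r r) ⟨
          d ^ℚ (r ℕ.+ r) * κ
            ≤⟨ d²ʳk≤n ⟩
          ν ∎

      -- A cop anywhere on an edge threatens all of it, so `r` moves must only lead to the edge, and
      -- the growth per edge is k d^r. The assumption says that this is at least √(nk), while (A.1)
      -- and the choice of `r` keep the number of targets at most √(n/k)/ξ.
      guard-edges : ∀ r′ → r ≡ suc r′ → ν ≤ d ^ℚ (r ℕ.+ r) * κ →
        ∃ λ c → n ℕ.^ c ℕ.≤ n ℕ.* n ℕ.* (n ℕ.∸ s) ℕ.^ c × CopsWin G (suc c)
      guard-edges r′ refl n≤d²ʳk = surround G r T (λ i y → y ∈? edge G i) 1≤s s≤n
        (λ v B S B⊆T isS → expansion⇒hall {s} {∣ B ∣} {∣ T v ∣} {k} {n} {∣ S ∣} {ξ} {κ * d ^ℚ r}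
          0≤ξ ξ≤1 (0≤* (0≤ℕ→ℚ k) (0≤^ 0≤d r)) (p⊆q⇒∣p∣≤∣q∣ B⊆T) ss≤ (T-small v) nk≤D²
          (subst (λ z → ξ * (z ⊓ ν) ≤ ℕ→ℚ ∣ S ∣) (*-assoc (ℕ→ℚ ∣ B ∣) κ (d ^ℚ r))
            (A3 B (toSubset (inV? B)) r S (s≤s z≤n)
              (λ x → mk⇔ (∈-toSubset⁻ (inV? B)) (∈-toSubset⁺ (inV? B))) (isNV B S isS))))
        respond
        where
        open ≤-Reasoning
        near? : ∀ v → Decidable (λ i → ∃ λ u → u ∈ edge G i × Walk G r′ v u)
        near? v i = Fin.any? (λ u → (u ∈? edge G i) ×-dec Walk? G r′ v u)
        T : Fin n → Subset (m G)
        T v = toSubset (near? v)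
        inV? : ∀ B → Decidable (λ x → ∃ λ i → i ∈ B × x ∈ edge G i)
        inV? B x = Fin.any? (λ i → (i ∈? B) ×-dec (x ∈? edge G i))
        isNV : ∀ B S → (∀ x → (x ∈ S ⇔ ∃ λ i → i ∈ B × ∃ λ y → Walk G r x y × y ∈ edge G i)) →
               IsNV G r (toSubset (inV? B)) S
        isNV B S isS x = mk⇔
          (λ x∈S → let (i , i∈B , y , w , y∈i) = Equivalence.to (isS x) x∈S in
             y , ∈-toSubset⁺ (inV? B) (i , i∈B , y∈i) , Walk⇒DistLe G r (Walk-sym G r w))
          (λ (y , y∈W , near) → let (i , i∈B , y∈i) = ∈-toSubset⁻ (inV? B) y∈W in
             Equivalence.from (isS x) (i , i∈B , y , Walk-sym G r (DistLe⇒Walk G near) , y∈i))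
        isNE : ∀ v → IsNE G r v (T v)
        isNE v i = mk⇔
          (λ i∈T → let (u , u∈i , w) = ∈-toSubset⁻ (near? v) i∈T in
             u , u∈i , Walk⇒DistLe G r′ (Walk-sym G r′ w))
          (λ (u , u∈i , near) → ∈-toSubset⁺ (near? v) (u , u∈i , Walk-sym G r′ (DistLe⇒Walk G near)))
        T-small : ∀ v → ξ * ℕ→ℚ ∣ T v ∣ * (ξ * ℕ→ℚ ∣ T v ∣) * κ ≤ ν
        T-small v = *-cancelˡ 0<κ (begin
          κ * (ξt * ξt * κ)
            ≡⟨ solve 2 (λ k x → k :* (x :* x :* k) := x :* k :* (x :* k)) refl κ ξt ⟩
          ξt * κ * (ξt * κ)
            ≤⟨ square-mono (0≤* (0≤* 0≤ξ (0≤ℕ→ℚ ∣ T v ∣)) (0≤ℕ→ℚ k)) (A1 v r (T v) (s≤s z≤n) (isNE v) d²ʳ≤) ⟩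
          d ^ℚ r * d ^ℚ r
            ≡⟨ ^-+ d r r ⟨
          d ^ℚ (r ℕ.+ r)
            ≤⟨ d²ʳ≤ ⟩
          ℕ→ℚ (n ℕ.* k)
            ≡⟨ trans (ℕ→ℚ-* n k) (*-comm ν κ) ⟩
          κ * ν ∎)
          where ξt = ξ * ℕ→ℚ ∣ T v ∣
        nk≤D² : ν * κ ≤ κ * d ^ℚ r * (κ * d ^ℚ r)
        nk≤D² = begin
          ν * κ
            ≤⟨ *-monoʳ (0≤ℕ→ℚ k) n≤d²ʳk ⟩
          d ^ℚ (r ℕ.+ r) * κ * κ
            ≡⟨ cong (λ z → z * κ * κ) (^-+ d r r) ⟩
          d ^ℚ r * d ^ℚ r * κ * κ
            ≡⟨ solve 2 (λ x k → x :* x :* k :* k := k :* x :* (k :* x)) refl (d ^ℚ r) κ ⟩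
          κ * d ^ℚ r * (κ * d ^ℚ r) ∎
        -- The edge used in the robber's last move contains `u′`, which is within r - 1 of `v`, so
        -- it is a target.
        follow : ∀ {v u′ u} → Walk G r′ v u′ → Move G u′ u →
                 ∃ λ i → i ∈ T v × (∀ {y} → y ∈ edge G i → Move G y u)
        follow {v} {u′} w (inj₂ (i , u′∈i , u∈i)) =
          i , ∈-toSubset⁺ (near? v) (u′ , u′∈i , w) , λ y∈i → inj₂ (i , y∈i , u∈i)
        -- The robber rested and used no edge; any edge through `u` is near enough to be a target,
        -- and one exists because `u` is not isolated.
        follow {v} {u} w (inj₁ refl) = let (i , u∈i) = in-some-edge u in
          i , ∈-toSubset⁺ (near? v) (u , u∈i , w) , λ y∈i → inj₂ (i , y∈i , u∈i)
        respond : ∀ {v u} → Walk G r v u → ∃ λ i → i ∈ T v × (∀ {y} → y ∈ edge G i → Move G y u)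
        respond w = let (_ , w′ , m) = unsnoc G r′ w in follow w′ m

      cops-surround : ∃ λ c → n ℕ.^ c ℕ.≤ n ℕ.* n ℕ.* (n ℕ.∸ s) ℕ.^ c × CopsWin G (suc c)
      cops-surround with d ^ℚ (r ℕ.+ r) * κ ≤? ν
      ... | yes d²ʳk≤n = guard-vertices d²ʳk≤n
      ... | no  d²ʳk≰n = guard-edges (ℕ.pred r) r≡ (<⇒≤ (≰⇒> d²ʳk≰n))
        where
        -- At r = 0 the vertex case would have applied, since then d^(2r) k = k ≤ n.
        r≡ : r ≡ suc (ℕ.pred r)
        r≡ = sym (ℕ.suc-pred r {{ℕ.≢-nonZero λ { refl → d²ʳk≰n
          (≤-trans (≤-reflexive (*-identityˡ κ)) (ℕ→ℚ-mono {k} {n} k≤n)) }}})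

    -- When s ≤ 1, ξ²√(nk) is at most 2, so the claimed bound is at least 10 n log n and a cop on
    -- every vertex is affordable.
    n-cops : ∀ {s} → s ℕ.≤ 1 → ξ⁴nk ≤ ℕ→ℚ (suc s) * ℕ→ℚ (suc s) → CopsWin G n × BoundHolds n n k ξ
    n-cops {s} s≤1 ξ⁴nk≤ = (id , λ r → inj₁ (r , refl)) , λ q 0≤q qq≤ → expPartial≤n-small 2≤n 0≤q
      (≤-trans (20qn≤c[s+1] {n} {n} {k} {s} {ξ} {q} ξ⁴nk≤ qq≤)
               (*-monoˡ (0≤ℕ→ℚ n) (ℕ→ℚ-mono {suc s} {2} (s≤s s≤1))))

    cop-number-bound : ∃ λ c → CopsWin G c × BoundHolds c n k ξ
    cop-number-bound =
      let (s , ss≤ , ¬s+1) = blockSize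
          (r , d²ʳ≤ , d²ʳ⁺²≰) = radius
          ξ⁴nk≤ = <⇒≤ (≰⇒> ¬s+1)
      in [ (λ s≤1 → n , n-cops s≤1 ξ⁴nk≤)
         , (λ 2≤s →
             let (c , n^c≤ , win) = cops-surround 2≤s ss≤ r d²ʳ≤ d²ʳ⁺²≰
             in suc c , win , λ q 0≤q qq≤ →
                  expPartial≤n {n} {s} c 2≤n (ℕ.<⇒≤ 2≤s) (≤√ξ⁴nk⇒≤n s ss≤) n^c≤ 0≤q
                    (20qn≤c[s+1] {suc c} {n} {k} {s} {ξ} {q} ξ⁴nk≤ qq≤)) ]′
         (ℕ.≤-<-connex s 1)

open Exponential using (ℕ→ℚ-cancel)
open Surrounding using (avgDeg≤n; cop-number-bound)
open import Data.Nat using (ℕ; _≤_; NonZero)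
open import Data.Rational using (ℚ)
open import Data.Rational.Properties using (≤-trans)
open import Data.Fin.Subset using (Subset)
open import Data.Fin using (Fin)
open import Data.Product using (∃; _×_; proj₁)

theorem1p5 : (k n : ℕ) → 2 ≤ k → .{{_ : NonZero n}} → (G : KGraph k n) →
    (ξ : ℚ) → (N1 : Fin n → Subset n) → IsN1 G N1 →
    Expanding G ξ (avgDeg G N1) →
    ∃ λ c → CopsWin G c × BoundHolds c n k ξ
theorem1p5 k n 2≤k G ξ N1 _ expanding = cop-number-bound 2≤k
  (ℕ→ℚ-cancel {k} {n} (≤-trans (proj₁ expanding) (avgDeg≤n G N1))) G ξ (avgDeg G N1) expanding
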